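{- Let $n\ge2$ and $\varepsilon\in\{\pm1\}^n$. Let $\{v_1,\dots,v_{n-1}\}$ be a cluster for $Q_\varepsilon$ with cluster matrix $V$, and let $T$ be the corresponding mixed cobinary tree, i.e. the unique (up to isomorphism) mixed cobinary tree with $\varepsilon(T)=\varepsilon$ and $\overline R(T)=F^{ -1}(E_\varepsilon^tS(V))$. Then, up to permutation, the $c$-vectors $c_1,\dots,c_{n-1}$ of $T$ are equal to the classical $c$-vectors $c_1',\dots,c_{n-1}'$ associated to the cluster $(v_i)$. Equivalently, after renumbering, $$v_i^tE_\varepsilon c_j=\delta_{ij}\qquad\text{for all } 1\le i,j\le n-1.$$
   Context: A mixed cobinary tree (MCT) with $n$ internal nodes is a finite tree $T$ linearly embedded in the $xy$-plane (vertices are points, edges are straight segments meeting only in common endpoints) such that: (1) $T$ has no horizontal edges. (2) The internal nodes (the vertices which are not leaves, a leaf being a vertex of degree one) have distinct $x$-coordinates, which are $1,2,\dots,n$; denote by $t_i$ the internal node with $x$-coordinate $i$. A neighbour (internal or leaf) of an internal node lying higher is called a parent of it, one lying lower a child of it. (3) Each internal node is either of positive type (a $\Lambda$-node), with two children and one parent, or of negative type (a V-node), with one child and two parents. (4) If $(x,y)$ is a positive node, then the vertical wall $\{(x,z): z<y\}$ is disjoint from $T$ and separates the two children of the node (one is to its left, one to its right). (5) If $(x,y)$ is a negative node, then the vertical wall $\{(x,z): z>y\}$ is disjoint from $T$ and separates the two parents of the node. The sign vector is $\varepsilon(T)=(\varepsilon_1,\dots,\varepsilon_n)$ with $\varepsilon_i=1$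 if $t_i$ is a $\Lambda$-node and $\varepsilon_i=-1$ if $t_i$ is a V-node. The bottom-to-top partial order on the internal nodes is the one generated by "each child is below its parent". Two MCTs with the same sign vector are isomorphic if their underlying trees are isomorphic by an isomorphism under which corresponding internal nodes have the same left-to-right total order (i.e. $t_i\mapsto t_i$) and the same bottom-to-top partial order. The $n-1$ internal edges of $T$ (edges joining two internal nodes) are numbered $\ell_1,\dots,\ell_{n-1}$; $\ell_i$ joins $t_{p_i}$ to $t_{q_i}$ with $p_i<q_i$, and $\mathrm{sgn}(\ell_i)=\pm1$ is the sign of its slope. The $c$-vector of $\ell_i$ is $c_i=\mathrm{sgn}(\ell_i)\sum_{p_i\le j<q_i}e_j\in\mathbb Z^{n-1}$. Put $R(T)=\{x\in\mathbb R^n: \mathrm{sgn}(\ell_i)(x_{q_i}-x_{p_i})>0 \text{ for } 1\le i\le n-1\}$ and let $\overline R(T)$ be its closure. Let $F:\mathbb R^n\to\mathbb R^{n-1}$, $F(x)=(x_2-x_1,x_3-x_2,\dots,x_n-x_{n-1})$. The quiver $Q_\varepsilon$ has vertices $1,\dots,n-1$ and, for $1\le i\le n-2$, one arrow between $i$ and $i+1$, which is $i+1\to i$ if $\varepsilon_{i+1}=1$ and $i\to i+1$ if $\varepsilon_{i+1}=-1$. Its Euler matrix $E_\varepsilon$ is the $(n-1)\times(n-1)$ matrix with $1$'s on the diagonal, $(i,j)$ entry $-1$ whenever there is an arrow $i\to j$, and all other entries $0$. The positive roots are $\beta_{pq}=\sum_{i=p}^{q-1}e_i\in\mathbb Z^{n-1}$,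 $1\le p<q\le n$. The projective roots $\pi_1,\dots,\pi_{n-1}$ are the rows of $E_\varepsilon^{ -1}$. An almost positive root is a positive root or a negative projective root $-\pi_i$. A cluster for $Q_\varepsilon$ is (identifying objects of the cluster category with their dimension vectors) a set of $n-1$ distinct almost positive roots $v_1,\dots,v_{n-1}$ such that $v_i^tE_\varepsilon v_j\ge0$ for all $i,j$ for which $v_j$ is a positive root. Its cluster matrix $V$ is the $(n-1)\times(n-1)$ matrix with columns $v_1,\dots,v_{n-1}$; it is invertible over $\mathbb Z$. $S(V)\subseteq\mathbb R^{n-1}$ is the set of all $\sum_i a_iv_i$ with all $a_i\ge0$. For every cluster there is a unique (up to isomorphism) MCT $T$ with $\varepsilon(T)=\varepsilon$ and $\overline R(T)=F^{ -1}(E_\varepsilon^tS(V))$; it is called the MCT corresponding to the cluster. The classical $c$-vectors $c'_1,\dots,c'_{n-1}$ of the cluster are the columns of the matrix $E_\varepsilon^{ -1}(V^t)^{ -1}=(V^tE_\varepsilon)^{ -1}$. -}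

module Defs where

open import Level using (Level; _⊔_; suc)
open import Algebra.Apartness.Bundles using (HeytingField; module HeytingCommutativeRing)
open import Algebra.Bundles using (CommutativeRing)
import Algebra.Definitions.RawMonoid as RawMonoidDefs
import Algebra.Properties.Semiring.Sum as SemiringSum
open import Data.Bool.Base using (if_then_else_; _∧_)
open import Data.Fin.Base as Fin using (Fin; toℕ; inject₁)
import Data.Fin.Properties as Fin
open import Data.Integer.Base as ℤ using (ℤ; +_; -[1+_]; 0ℤ; 1ℤ; -1ℤ; _◃_)
import Data.Integer.Properties as ℤ
open import Data.List.Base using (_∷_; _++_; [_])
open import Data.List.Relation.Unary.Linked using (Linked)
open import Data.List.Relation.Unary.Unique.Propositional using (Unique)
open import Data.Nat.Base as ℕ using (ℕ)
import Data.Nat.Properties as ℕ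
open import Data.Product using (∃₂; ∃!; ∃-syntax; Σ-syntax; _×_; _,_)
open import Data.Sign.Base as Sign using (Sign)
import Data.Sign.Properties as Sign
open import Data.Sum.Base using (_⊎_; [_,_]′)
open import Data.Vec.Functional using (Vector; transpose)
open import Function.Base using (const)
open import Relation.Binary.Construct.Closure.ReflexiveTransitive using (Star)
open import Relation.Binary.Core using (Rel)
open import Relation.Binary.Definitions using (Decidable; Symmetric; Irreflexive)
open import Relation.Binary.PropositionalEquality.Core using (_≡_; _≢_; _≗_)
open import Relation.Binary.Structures using (IsStrictPartialOrder)
open import Relation.Nullary using (¬_; does)
open import Relation.Nullary.Decidable using (_×-dec_; _⊎-dec_)
open import Relation.Unary using (Pred; _⊢_)

open SemiringSum ℤ.+-*-semiring using () renaming (sum to sumℤ)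

------------------------------------------------------------------------
-- Throughout, n = suc r: there are n internal nodes and r = n - 1
-- internal edges, quiver vertices, etc.  All indices start at 0.

------------------------------------------------------------------------
-- Integer vectors and matrices; M i j is the entry in row i, column j.

Matrix : ℕ → Set
Matrix r = Vector (Vector ℤ r) r

δ : ∀ {r} → Matrix r
δ i j = if does (i Fin.≟ j) then 1ℤ else 0ℤ

infixl 7 _⊗_
_⊗_ : ∀ {r} → Matrix r → Matrix r → Matrix r
(A ⊗ B) i j = sumℤ λ k → A i k ℤ.* B k j

_ᵀ : ∀ {r} → Matrix r → Matrix r
_ᵀ = transpose

IsInverse : ∀ {r} → Matrix r → Matrix r → Set
IsInverse A B = (∀ i j → (A ⊗ B) i j ≡ δ i j) × (∀ i j → (B ⊗ A) i j ≡ δ i j)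

columns : ∀ {r} → Vector (Vector ℤ r) r → Matrix r
columns v k i = v i k

-- form v M w = vᵗ M w
form : ∀ {r} → Vector ℤ r → Matrix r → Vector ℤ r → ℤ
form v M w = sumℤ λ k → sumℤ λ l → v k ℤ.* M k l ℤ.* w l

-- β p q = Σ_{p ≤ j < q} e_j
β : ∀ {r} → Fin (ℕ.suc r) → Fin (ℕ.suc r) → Vector ℤ r
β p q j =
  if does (toℕ p ℕ.≤? toℕ j) ∧ does (toℕ j ℕ.<? toℕ q) then 1ℤ else 0ℤ

------------------------------------------------------------------------
-- The quiver Q_ε, almost positive roots and clusters

module _ {r : ℕ} (ε : Vector Sign (ℕ.suc r)) where

  -- The orientation of the edge between consecutive vertices a and a + 1
  -- is governed by ε at position a + 1 (with 0-based positions, the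
  -- middle one of the three nodes a, a + 1, a + 2).
  Arrow : Fin r → Fin r → Set
  Arrow i j =
    (toℕ j ≡ ℕ.suc (toℕ i) × ε (Fin.suc i) ≡ Sign.-) ⊎
    (toℕ i ≡ ℕ.suc (toℕ j) × ε (Fin.suc j) ≡ Sign.+)

  arrow? : Decidable Arrow
  arrow? i j =
    ((toℕ j ℕ.≟ ℕ.suc (toℕ i)) ×-dec (ε (Fin.suc i) Sign.≟ Sign.-)) ⊎-dec
    ((toℕ i ℕ.≟ ℕ.suc (toℕ j)) ×-dec (ε (Fin.suc j) Sign.≟ Sign.+))

  eulerMatrix : Matrix r
  eulerMatrix i j =
    if does (i Fin.≟ j) then 1ℤ else
    if does (arrow? i j) then -1ℤ else 0ℤ

  PositiveRoot : Pred (Vector ℤ r) _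
  PositiveRoot w = ∃₂ λ p q → p Fin.< q × w ≗ β p q

  -- π is the i-th row of the inverse of the Euler matrix.
  ProjectiveRoot : Fin r → Pred (Vector ℤ r) _
  ProjectiveRoot i π = Σ[ E⁻¹ ∈ Matrix r ] IsInverse eulerMatrix E⁻¹ × π ≗ E⁻¹ i

  NegativeProjectiveRoot : Pred (Vector ℤ r) _
  NegativeProjectiveRoot w =
    ∃₂ λ i π → ProjectiveRoot i π × (∀ k → w k ≡ ℤ.- π k)

  AlmostPositiveRoot : Pred (Vector ℤ r) _
  AlmostPositiveRoot w = PositiveRoot w ⊎ NegativeProjectiveRoot w

  record IsCluster (v : Vector (Vector ℤ r) r) : Set where
    field
      almostPositive : ∀ i → AlmostPositiveRoot (v i)
      distinct       : ∀ i j → v i ≗ v j → i ≡ j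
      compatible     : ∀ i j → PositiveRoot (v j) →
                       0ℤ ℤ.≤ form (v i) eulerMatrix (v j)

  -- The c′ j are the columns of (VᵗE)⁻¹, where V has columns v i.
  AreClassicalCVectors : (v c′ : Vector (Vector ℤ r) r) → Set
  AreClassicalCVectors v c′ =
    IsInverse ((columns v) ᵀ ⊗ eulerMatrix) (columns c′)

------------------------------------------------------------------------
-- The real numbers, up to isomorphism: a Cauchy complete Archimedean
-- ordered field.  No decidability of the order is assumed, so that the
-- constructive reals are a model as well as the classical ones.

record Reals c ℓ₁ ℓ₂ : Set (suc (c ⊔ ℓ₁ ⊔ ℓ₂)) where
  field
    heytingField : HeytingField c ℓ₁ ℓ₂

  open HeytingField heytingField public

  commutativeRing : CommutativeRing c ℓ₁
  commutativeRing =
    HeytingCommutativeRing.commutativeRing heytingCommutativeRing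

  open CommutativeRing commutativeRing public
    using (semiring; +-rawMonoid)
  open RawMonoidDefs +-rawMonoid public
    using () renaming (_×_ to _·_)
  open SemiringSum semiring public
    using (sum)

  infix 4 _<_ _≤_
  field
    _<_                  : Rel Carrier ℓ₂
    isStrictPartialOrder : IsStrictPartialOrder _≈_ _<_
    #⇒<⊎>                : ∀ {x y} → x # y → x < y ⊎ y < x
    <⇒#                  : ∀ {x y} → x < y → x # y
    +-monoˡ-<            : ∀ z {x y} → x < y → x + z < y + z
    *-pos                : ∀ {x y} → 0# < x → 0# < y → 0# < x * y

  _≤_ : Rel Carrier ℓ₂
  x ≤ y = ¬ (y < x)

  fromℕ : ℕ → Carrier
  fromℕ k = k · 1#

  -- ∣ x - y ∣ < e
  Within : Carrier → Carrier → Carrier → Set ℓ₂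
  Within e x y = - e < x - y × x - y < e

  field
    archimedean : ∀ x → ∃[ k ] x < fromℕ k
    complete    : ∀ (s : ℕ → Carrier) →
      (∀ e → 0# < e → ∃[ N ] (∀ i j → N ℕ.≤ i → N ℕ.≤ j → Within e (s i) (s j))) →
      ∃[ x ] (∀ e → 0# < e → ∃[ N ] (∀ i → N ℕ.≤ i → Within e (s i) x))

  fromℤ : ℤ → Carrier
  fromℤ (+ k)    = fromℕ k
  fromℤ -[1+ k ] = - fromℕ (ℕ.suc k)

------------------------------------------------------------------------
-- Mixed cobinary trees

Exactly₂ : ∀ {a p} {A : Set a} → Pred A p → Set (a ⊔ p)
Exactly₂ P = ∃₂ λ a b → a ≢ b × P a × P b × (∀ u → P u → u ≡ a ⊎ u ≡ b)

Exactly₁ : ∀ {a p} {A : Set a} → Pred A p → Set (a ⊔ p)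
Exactly₁ P = ∃! _≡_ P

record FiniteGraph : Set₁ where
  infix 4 _~_
  field
    size   : ℕ

  Vertex : Set
  Vertex = Fin size

  field
    _~_    : Rel Vertex Level.zero
    _~?_   : Decidable _~_
    sym    : Symmetric _~_
    irrefl : Irreflexive _≡_ _~_

  Leaf : Pred Vertex _
  Leaf u = Exactly₁ (u ~_)

  Internal : Pred Vertex _
  Internal u = ¬ Leaf u

  Connected : Set
  Connected = ∀ u v → Star _~_ u v

  -- No cycle u ~ v ~ w ~ … ~ u through at least three vertices, all distinct.
  Acyclic : Set
  Acyclic = ∀ u v w ws → Unique (u ∷ v ∷ w ∷ ws) →
            ¬ Linked _~_ (u ∷ v ∷ w ∷ ws ++ [ u ])

module _ {c ℓ₁ ℓ₂ : Level} (ℝ : Reals c ℓ₁ ℓ₂) where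

  open Reals ℝ hiding (sym; complete)

  record PlaneTree : Set (suc Level.zero ⊔ c ⊔ ℓ₁ ⊔ ℓ₂) where
    field
      graph : FiniteGraph

    open FiniteGraph graph public

    field
      connected : Connected
      acyclic   : Acyclic
      X Y       : Vertex → Carrier

    OnEdge : Carrier × Carrier → Vertex → Vertex → Set _
    OnEdge (x , y) u v = ∃[ s ] 0# ≤ s × s ≤ 1# ×
      x ≈ (1# - s) * X u + s * X v ×
      y ≈ (1# - s) * Y u + s * Y v

    OnTree : Pred (Carrier × Carrier) _
    OnTree P = ∃₂ λ u v → u ~ v × OnEdge P u v

    SameEdge : (u v u′ v′ : Vertex) → Set
    SameEdge u v u′ v′ = (u ≡ u′ × v ≡ v′) ⊎ (u ≡ v′ × v ≡ u′)

    CommonEndpoint : Carrier × Carrier → (u v u′ v′ : Vertex) → Set _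
    CommonEndpoint (x , y) u v u′ v′ = ∃[ w ]
      (w ≡ u ⊎ w ≡ v) × (w ≡ u′ ⊎ w ≡ v′) × x ≈ X w × y ≈ Y w

    field
      points-distinct : ∀ u v → X u ≈ X v → Y u ≈ Y v → u ≡ v
      edges-disjoint  : ∀ {u v u′ v′} P → u ~ v → u′ ~ v′ →
        OnEdge P u v → OnEdge P u′ v′ →
        SameEdge u v u′ v′ ⊎ CommonEndpoint P u v u′ v′

    Parent Child : Vertex → Pred Vertex _
    Parent u v = u ~ v × Y u < Y v
    Child  u v = u ~ v × Y v < Y u

    Positive Negative : Pred Vertex _
    Positive u = Exactly₂ (Child u) × Exactly₁ (Parent u)
    Negative u = Exactly₁ (Child u) × Exactly₂ (Parent u)

    Separates : Carrier → Vertex → Vertex → Set _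
    Separates x u v = (X u < x × x < X v) ⊎ (X v < x × x < X u)

  record MCT (r : ℕ) : Set (suc Level.zero ⊔ c ⊔ ℓ₁ ⊔ ℓ₂) where
    field
      planeTree : PlaneTree

    open PlaneTree planeTree public

    field
      no-horizontal : ∀ {u v} → u ~ v → Y u # Y v

      -- t i is the internal node with x-coordinate i + 1.
      t             : Fin (ℕ.suc r) → Vertex
      t-internal    : ∀ i → Internal (t i)
      t-complete    : ∀ u → Internal u → ∃[ i ] u ≡ t i
      X-t           : ∀ i → X (t i) ≈ fromℕ (ℕ.suc (toℕ i))

      node-type     : ∀ i → Positive (t i) ⊎ Negative (t i)

      wall-below    : ∀ i → Positive (t i) → ∀ x y → OnTree (x , y) →
                      x ≈ X (t i) → ¬ y < Y (t i)
      separates-children : ∀ i → Positive (t i) → ∀ u v → u ≢ v →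
                      Child (t i) u → Child (t i) v → Separates (X (t i)) u v

      wall-above    : ∀ i → Negative (t i) → ∀ x y → OnTree (x , y) →
                      x ≈ X (t i) → ¬ Y (t i) < y
      separates-parents : ∀ i → Negative (t i) → ∀ u v → u ≢ v →
                      Parent (t i) u → Parent (t i) v → Separates (X (t i)) u v

    signVector : Vector Sign (ℕ.suc r)
    signVector i = [ const Sign.+ , const Sign.- ]′ (node-type i)

    -- For an edge u ~ v with u to the left of v, the slope has the sign
    -- of Y v - Y u.
    slopeSign : ∀ {u v} → u ~ v → Sign
    slopeSign u~v = [ const Sign.+ , const Sign.- ]′ (#⇒<⊎> (no-horizontal u~v))

    record EdgeNumbering : Set where
      field
        p q       : Fin r → Fin (ℕ.suc r)
        p<q       : ∀ i → p i Fin.< q i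
        adjacent  : ∀ i → t (p i) ~ t (q i)
        injective : ∀ i j → p i ≡ p j → q i ≡ q j → i ≡ j
        complete  : ∀ a b → a Fin.< b → t a ~ t b →
                    ∃[ i ] p i ≡ a × q i ≡ b

      sgn : Fin r → ℤ
      sgn i = slopeSign (adjacent i) ◃ 1

      cVector : Vector (Vector ℤ r) r
      cVector i j = sgn i ℤ.* β (p i) (q i) j

      region : Pred (Vector Carrier (ℕ.suc r)) _
      region x = ∀ i → 0# < fromℤ (sgn i) * (x (q i) - x (p i))

  closure : ∀ {ℓ k} → Pred (Vector Carrier k) ℓ → Pred (Vector Carrier k) _
  closure {k = k} P x =
    ∀ e → 0# < e → Σ[ y ∈ Vector Carrier k ] P y × (∀ i → Within e (x i) (y i))

  differences : ∀ {r} → Vector Carrier (ℕ.suc r) → Vector Carrier r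
  differences x i = x (Fin.suc i) - x (inject₁ i)

  cone : ∀ {r} → Vector (Vector ℤ r) r → Pred (Vector Carrier r) _
  cone {r} v z = Σ[ a ∈ Vector Carrier r ] (∀ i → 0# ≤ a i) ×
    (∀ k → z k ≈ sum {r} λ i → a i * fromℤ (v i k))

  image : ∀ {ℓ r} → Matrix r → Pred (Vector Carrier r) ℓ → Pred (Vector Carrier r) _
  image {r = r} M P z = Σ[ s ∈ Vector Carrier r ] P s ×
    (∀ j → z j ≈ sum {r} λ k → fromℤ (M j k) * s k)

  -- F⁻¹(Eᵗ S(V))
  clusterRegion : ∀ {r} → Vector Sign (ℕ.suc r) → Vector (Vector ℤ r) r →
                  Pred (Vector Carrier (ℕ.suc r)) _
  clusterRegion ε v = differences ⊢ image ((eulerMatrix ε) ᵀ) (cone v)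

-- Let E be the Euler matrix.  Write y_k for the vector of partial sums of Eᵗ v_k,
-- so that v_kᵗ E c_l = sgn(ℓ_l) (y_k(q_l) - y_k(p_l)) =: N_lk.  Dually, let h_i(m)
-- count, with signs, how often a walk from the first node to the node m crosses
-- ℓ_i; as T is a tree this does not depend on the walk, and the sgn(ℓ_i) h_i are
-- dual to the c-vectors, over the integers.  One inclusion between the two cones
-- gives N ≥ 0.  The other one expresses sgn(ℓ_i) h_i as a nonnegative real
-- combination of the y_k, i.e. it gives a real matrix A ≥ 0 with A Nᵗ = I.
-- Hence N is a permutation matrix up to positive integer factors, and these
-- factors are 1 because Eᵗ v has an entry ±1 for every almost positive root v.

module Submission where

open import Defs
open import Algebra.Bundles using (CommutativeRing; Semiring)
import Algebra.Apartness.Properties.HeytingCommutativeRing as HCR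
import Algebra.Properties.Ring as RingProperties
import Algebra.Properties.Semiring.Mult as SemiringMult
import Algebra.Properties.Semiring.Sum as SemiringSum
import Algebra.Solver.Ring as RingSolver
open import Algebra.Solver.Ring.AlmostCommutativeRing using (fromCommutativeRing; _-Raw-AlmostCommutative⟶_)
open import Data.Bool.Base using (if_then_else_; _∧_)
open import Data.Bool.Properties using (∧-zeroʳ)
open import Data.Empty using (⊥)
open import Data.Fin.Base as Fin using (Fin; toℕ; inject₁)
open import Data.Fin.Permutation using (Permutation′; permutation; _⟨$⟩ʳ_)
import Data.Fin.Properties as Fin
open import Data.Integer.Base as ℤ using (ℤ; +_; -[1+_]; 0ℤ; 1ℤ; -1ℤ; _◃_)
import Data.Integer.Properties as ℤ
open import Data.Integer.Tactic.RingSolver using (solve-∀)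
open import Data.List.Base as List using (List; []; _∷_; _++_; [_])
import Data.List.Membership.DecPropositional as DecMembership
open import Data.List.Membership.Propositional using (_∈_)
open import Data.List.Properties using (map-++)
open import Data.List.Relation.Unary.All as All using ([]; _∷_)
open import Data.List.Relation.Unary.All.Properties using (¬Any⇒All¬)
open import Data.List.Relation.Unary.AllPairs using ([]; _∷_)
open import Data.List.Relation.Unary.Any using (here; there)
open import Data.List.Relation.Unary.Linked using (Linked; [-]; _∷_)
import Data.List.Relation.Unary.Linked.Properties as Linked
open import Data.List.Relation.Unary.Unique.Propositional using (Unique)
import Data.List.Relation.Unary.Unique.Propositional.Properties as Unique
open import Data.Maybe.Base using (Maybe; just; nothing)
open import Data.Nat.Base as ℕ using (ℕ)
import Data.Nat.Properties as ℕ
open import Data.Product.Base using (Σ-syntax; ∃-syntax; _×_; _,_; proj₁; proj₂)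
open import Data.Sign.Base as Sign using (Sign)
open import Data.Sum.Base using (_⊎_; inj₁; inj₂)
open import Data.Vec.Functional using (Vector)
open import Function.Base using (_∘_)
open import Relation.Binary.Construct.Closure.ReflexiveTransitive using (Star; _◅_; _◅◅_) renaming (ε to nil)
open import Relation.Binary.Core using (Rel)
open import Relation.Binary.Definitions using (DecidableEquality; tri<; tri≈; tri>)
import Relation.Binary.PropositionalEquality as ≡
open ≡ using (_≡_; _≢_; _≗_)
import Relation.Binary.Reasoning.Setoid as SetoidReasoning
open import Relation.Binary.Structures using (IsStrictPartialOrder)
open import Relation.Nullary using (¬_; Dec; does; yes; no; contradiction)
open import Relation.Nullary.Decidable using (dec-true; dec-false; decidable-stable; _×-dec_)
open import Relation.Unary using (Pred; _≐_)

-- Sums and telescoping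

-- The order on the reals is not decidable, so the real coefficients serve only to locate nonzero
-- entries: a nonzero summand is extracted from apartness, and trichotomy is invoked only for
-- integers and indices. The closure is defined by approximation, which costs one quantitative step
-- in each direction: even integer points against tolerance 1, and small multiples of an integer
-- interior point. The factors are 1 by divisibility. When column k of N is supported in a single
-- row i, expanding y_k along the tree edges leaves one term, so Eᵗ v_k is N_ik times an integer
-- vector and N_ik divides each of its entries. The entry ±1 sits at a source of the support if v_k
-- is a positive root, and at the vertex m if v_k = -π_m.

module SumLemmas {a b} (R : Semiring a b) where
  open Semiring R
  open SemiringSum R

  sum-zero : ∀ {n} {f : Vector Carrier n} → (∀ i → f i ≈ 0#) → sum f ≈ 0#
  sum-zero {n} f≈0 = trans (sum-cong-≋ f≈0) (sum-replicate-zero n)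

  sum-single : ∀ {n} {f : Vector Carrier n} i → (∀ j → j ≢ i → f j ≈ 0#) → sum f ≈ f i
  sum-single {ℕ.suc n} {f} i f≈0 = trans (sum-remove {i = i} f)
    (trans (+-congˡ (sum-zero λ j → f≈0 (Fin.punchIn i j) (Fin.punchInᵢ≢i i j)))
      (+-identityʳ (f i)))

  *-sum-sum : ∀ {m n} (s : Vector Carrier m) (t : Vector Carrier n) (M : Fin m → Fin n → Carrier) →
    sum (λ k → s k * sum (λ l → M k l * t l)) ≈ sum (λ l → sum (λ k → s k * M k l) * t l)
  *-sum-sum s t M = trans
    (sum-cong-≋ λ k → trans (*-distribˡ-sum (s k) (λ l → M k l * t l))
      (sum-cong-≋ λ l → sym (*-assoc (s k) (M k l) (t l))))
    (trans (∑-comm (λ k l → s k * M k l * t l))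
      (sum-cong-≋ λ l → sym (*-distribʳ-sum (t l) (λ k → s k * M k l))))

open SemiringSum ℤ.+-*-semiring using ()
  renaming (sum to sumℤ; sum-cong-≋ to sumℤ-cong; *-distribˡ-sum to *-distribˡ-sumℤ;
            ∑-distrib-+ to sumℤ-+; ∑-permute to sumℤ-permute)
open SumLemmas ℤ.+-*-semiring
  renaming (sum-zero to sumℤ-zero; sum-single to sumℤ-single; *-sum-sum to *-sumℤ-sumℤ)

δ-refl : ∀ {r} (i : Fin r) → δ i i ≡ 1ℤ
δ-refl i = ≡.cong (if_then 1ℤ else 0ℤ) (dec-true (i Fin.≟ i) ≡.refl)

δ-≢ : ∀ {r} {i j : Fin r} → i ≢ j → δ i j ≡ 0ℤ
δ-≢ {i = i} {j} i≢j = ≡.cong (if_then 1ℤ else 0ℤ) (dec-false (i Fin.≟ j) i≢j)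

δ-nonneg : ∀ {r} (i j : Fin r) → 0ℤ ℤ.≤ δ i j
δ-nonneg i j with i Fin.≟ j
... | yes _ = ℤ.+≤+ ℕ.z≤n
... | no  _ = ℤ.+≤+ ℕ.z≤n

Δ : ∀ {r} → Vector ℤ (ℕ.suc r) → Vector ℤ r
Δ x j = x (Fin.suc j) ℤ.- x (inject₁ j)

-- A discrete antiderivative, normalised to vanish at the first node. It moves `v ⊡ E` to the nodes,
-- where pairing with `β p q` becomes a difference of two values.
potential : ∀ {r} → Vector ℤ r → Vector ℤ (ℕ.suc r)
potential z Fin.zero = 0ℤ
potential {ℕ.suc r} z (Fin.suc i) = z Fin.zero ℤ.+ potential (z ∘ Fin.suc) i

Δ-potential : ∀ {r} (z : Vector ℤ r) → Δ (potential z) ≗ z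
Δ-potential z Fin.zero = solve (z Fin.zero)
  where
  solve : ∀ a → (a ℤ.+ 0ℤ) ℤ.- 0ℤ ≡ a
  solve = solve-∀
Δ-potential {ℕ.suc (ℕ.suc r)} z (Fin.suc j) =
  ≡.trans (cancel (z Fin.zero) (potential (z ∘ Fin.suc) (Fin.suc j)) (potential (z ∘ Fin.suc) (inject₁ j)))
    (Δ-potential (z ∘ Fin.suc) j)
  where
  cancel : ∀ a b c → (a ℤ.+ b) ℤ.- (a ℤ.+ c) ≡ b ℤ.- c
  cancel = solve-∀

β-suc-suc : ∀ {r} (p q : Fin (ℕ.suc r)) j → β (Fin.suc p) (Fin.suc q) (Fin.suc j) ≡ β p q j
β-suc-suc Fin.zero    q j = ≡.refl
β-suc-suc (Fin.suc p) q j = ≡.refl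

telescope : ∀ {r} (x : Vector ℤ (ℕ.suc r)) {p q} → p Fin.≤ q →
  sumℤ (λ j → Δ x j ℤ.* β p q j) ≡ x q ℤ.- x p
telescope x {Fin.zero} {Fin.zero} _ =
  ≡.trans (sumℤ-zero λ j → ℤ.*-zeroʳ (Δ x j)) (≡.sym (ℤ.+-inverseʳ (x Fin.zero)))
telescope {ℕ.suc r} x {Fin.zero} {Fin.suc q} _ =
  ≡.trans (≡.cong (λ t → Δ x Fin.zero ℤ.* 1ℤ ℤ.+ t) (telescope (x ∘ Fin.suc) {Fin.zero} {q} ℕ.z≤n))
    (chain (x Fin.zero) (x (Fin.suc Fin.zero)) (x (Fin.suc q)))
  where
  chain : ∀ a b c → (b ℤ.- a) ℤ.* 1ℤ ℤ.+ (c ℤ.- b) ≡ c ℤ.- a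
  chain = solve-∀
telescope {ℕ.suc r} x {Fin.suc p} {Fin.suc q} (ℕ.s≤s p≤q) =
  ≡.trans (≡.cong₂ ℤ._+_ (ℤ.*-zeroʳ (Δ x Fin.zero))
      (sumℤ-cong λ j → ≡.cong (Δ x (Fin.suc j) ℤ.*_) (β-suc-suc p q j)))
    (≡.trans (ℤ.+-identityˡ _) (telescope (x ∘ Fin.suc) p≤q))

infixl 7 _⊡_
_⊡_ : ∀ {r} → Vector ℤ r → Matrix r → Vector ℤ r
(v ⊡ M) l = sumℤ λ k → v k ℤ.* M k l

form-⊡ : ∀ {r} (v : Vector ℤ r) M w → form v M w ≡ sumℤ (λ l → (v ⊡ M) l ℤ.* w l)
form-⊡ v M w = ≡.trans
  (sumℤ-cong λ k → ≡.trans (sumℤ-cong λ l → ℤ.*-assoc (v k) (M k l) (w l))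
    (≡.sym (*-distribˡ-sumℤ (v k) (λ l → M k l ℤ.* w l))))
  (*-sumℤ-sumℤ v w M)

form-β : ∀ {r} (v : Vector ℤ r) M s {p q} → p Fin.≤ q →
  form v M (λ j → s ℤ.* β p q j) ≡ s ℤ.* (potential (v ⊡ M) q ℤ.- potential (v ⊡ M) p)
form-β v M s {p} {q} p≤q = begin
  form v M (λ j → s ℤ.* β p q j)               ≡⟨ form-⊡ v M _ ⟩
  sumℤ (λ l → (v ⊡ M) l ℤ.* (s ℤ.* β p q l))   ≡⟨ sumℤ-cong (λ l →
    ≡.trans (≡.cong (ℤ._* (s ℤ.* β p q l)) (≡.sym (Δ-potential (v ⊡ M) l))) (swap (Δ y l) s (β p q l))) ⟩
  sumℤ (λ l → s ℤ.* (Δ y l ℤ.* β p q l))       ≡⟨ *-distribˡ-sumℤ s (λ l → Δ y l ℤ.* β p q l) ⟨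
  s ℤ.* sumℤ (λ l → Δ y l ℤ.* β p q l)         ≡⟨ ≡.cong (s ℤ.*_) (telescope y p≤q) ⟩
  s ℤ.* (y q ℤ.- y p)                          ∎
  where
  open ≡.≡-Reasoning
  y = potential (v ⊡ M)
  swap : ∀ a b c → a ℤ.* (b ℤ.* c) ≡ b ℤ.* (a ℤ.* c)
  swap = solve-∀

-- Reads a coordinate of a c-vector as the rise of a function on the nodes, the form that
-- `Δ-expansion` takes in the second half of `IsInverse`.
β-potential : ∀ {r} {p q : Fin (ℕ.suc r)} (i : Fin r) → p Fin.≤ q →
  potential (δ i) q ℤ.- potential (δ i) p ≡ β p q i
β-potential {p = p} {q} i p≤q = begin
  x q ℤ.- x p                         ≡⟨ telescope x p≤q ⟨
  sumℤ (λ j → Δ x j ℤ.* β p q j)      ≡⟨ sumℤ-single i (λ j j≢i →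
    ≡.cong (ℤ._* β p q j) (≡.trans (Δ-potential (δ i) j) (δ-≢ (j≢i ∘ ≡.sym)))) ⟩
  Δ x i ℤ.* β p q i                   ≡⟨ ≡.cong (ℤ._* β p q i) (≡.trans (Δ-potential (δ i) i) (δ-refl i)) ⟩
  1ℤ ℤ.* β p q i                      ≡⟨ ℤ.*-identityˡ _ ⟩
  β p q i                             ∎
  where
  open ≡.≡-Reasoning
  x = potential (δ i)

-- The permutation is inverse to `f` because the application chooses a column for each row and then
-- needs the row of each column.
injective⇒permutation : ∀ {n} (f : Fin n → Fin n) → (∀ {i j} → f i ≡ f j → i ≡ j) →
  Σ[ σ ∈ Permutation′ n ] (∀ i → f (σ ⟨$⟩ʳ i) ≡ i)
injective⇒permutation f f-inj =
  permutation (proj₁ ∘ surj) f (λ i → f-inj (proj₂ (surj (f i)))) (proj₂ ∘ surj) , proj₂ ∘ surj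
  where
  surj : ∀ k → ∃[ i ] f i ≡ k
  surj k with Fin.any? (λ i → f i Fin.≟ k)
  ... | yes hit  = hit
  ... | no  miss = contradiction (avoid f f-inj (λ i eq → miss (i , eq))) λ ()
    where
    avoid : ∀ {n} {k} (f : Fin n → Fin n) → (∀ {i j} → f i ≡ f j → i ≡ j) →
      (∀ i → f i ≢ k) → ⊥
    -- If `k` were missed, punching it out would inject `Fin (suc n)` into `Fin n`.
    avoid {ℕ.suc n} {k} f f-inj f≢k = ℕ.1+n≰n (Fin.injective⇒≤ {f = λ i → Fin.punchOut (≡.≢-sym (f≢k i))}
      λ eq → f-inj (Fin.punchOut-injective (≡.≢-sym (f≢k _)) (≡.≢-sym (f≢k _)) eq))

-- Walks in trees

module Walks {a b} {V : Set a} {_~_ : Rel V b} (_≟_ : DecidableEquality V)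
  (~-sym : ∀ {u v} → u ~ v → v ~ u) (~-irrefl : ∀ {u} → ¬ u ~ u)
  (~-acyclic : ∀ u v w ws → Unique (u ∷ v ∷ w ∷ ws) → ¬ Linked _~_ (u ∷ v ∷ w ∷ ws ++ [ u ]))
  where

  open DecMembership _≟_ using (_∈?_)

  vertices : ∀ {u v} → Star _~_ u v → List V
  vertices {u} nil     = u ∷ []
  vertices {u} (_ ◅ w) = u ∷ vertices w

  -- Cuts the path at its visit of `u` and arranges the vertices as the list that `~-acyclic`
  -- expects once the edges leading from `u` to the start of the path are put in front.
  initialSegment : ∀ {u x v} (w : Star _~_ x v) → Unique (vertices w) → u ∈ vertices w → u ≢ x →
    ∃[ ws ] Linked _~_ (x ∷ ws ++ [ u ]) × Unique (u ∷ x ∷ ws) × (∀ {z} → z ∈ x ∷ ws → z ∈ vertices w)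
  initialSegment nil     _ (here u≡x) u≢x = contradiction u≡x u≢x
  initialSegment (e ◅ w) _ (here u≡x) u≢x = contradiction u≡x u≢x
  initialSegment {u} (_◅_ {j = y} e w) (x∉w ∷ uniq) (there u∈w) u≢x with u ≟ y
  ... | yes ≡.refl = [] , e ∷ [-] , (u≢x ∷ []) ∷ [] ∷ [] , λ { (here z≡x) → here z≡x }
  ... | no u≢y with initialSegment w uniq u∈w u≢y
  ...   | ws , linked , (u∉ws ∷ ws!) , ws⊆w =
    y ∷ ws , e ∷ linked , (u≢x ∷ u∉ws) ∷ All.tabulate (λ z∈ → All.lookup x∉w (ws⊆w z∈)) ∷ ws! ,
    λ { (here z≡x) → here z≡x ; (there z∈) → there (ws⊆w z∈) }

  module Flow (f : V → V → ℤ) (f-anti : ∀ u v → f v u ≡ ℤ.- f u v) where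

    -- The integral of the 1-cochain `f` along a walk.
    flow : ∀ {u v} → Star _~_ u v → ℤ
    flow nil = 0ℤ
    flow (_◅_ {u} {v} _ w) = f u v ℤ.+ flow w

    flow-◅◅ : ∀ {u v x} (w : Star _~_ u v) (w′ : Star _~_ v x) → flow (w ◅◅ w′) ≡ flow w ℤ.+ flow w′
    flow-◅◅ nil w′ = ≡.sym (ℤ.+-identityˡ (flow w′))
    flow-◅◅ (_◅_ {u} {v} _ w) w′ =
      ≡.trans (≡.cong (λ t → f u v ℤ.+ t) (flow-◅◅ w w′)) (≡.sym (ℤ.+-assoc (f u v) (flow w) (flow w′)))

    backtrack : ∀ u v c → f u v ℤ.+ (f v u ℤ.+ c) ≡ c
    backtrack u v c = ≡.trans (≡.cong (λ s → f u v ℤ.+ (s ℤ.+ c)) (f-anti u v)) (cancel (f u v) c)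
      where
      cancel : ∀ s c → s ℤ.+ (ℤ.- s ℤ.+ c) ≡ c
      cancel = solve-∀

    reversed : ∀ {u v} (w : Star _~_ u v) → ∃[ w′ ] flow {v} {u} w′ ≡ ℤ.- flow w
    reversed nil = nil , ≡.refl
    reversed (_◅_ {u} {v} e w) with reversed w
    ... | w′ , eq = w′ ◅◅ ~-sym e ◅ nil ,
      ≡.trans (flow-◅◅ w′ (~-sym e ◅ nil))
        (≡.trans (≡.cong₂ (λ s c → s ℤ.+ (c ℤ.+ 0ℤ)) eq (f-anti u v)) (negate (flow w) (f u v)))
      where
      negate : ∀ s c → ℤ.- s ℤ.+ (ℤ.- c ℤ.+ 0ℤ) ≡ ℤ.- (c ℤ.+ s)
      negate = solve-∀

    -- If `u` already lies on the path, it must be its second vertex, since a later visit would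
    -- close a cycle through `u`, `x` and `y`. Then the step from `u` to `x` is undone at once, and
    -- dropping both steps keeps the flow by antisymmetry.
    prepend : ∀ {u x v} → u ~ x → (w : Star _~_ x v) → Unique (vertices w) →
      Σ[ w′ ∈ Star _~_ u v ] Unique (vertices w′) × flow w′ ≡ f u x ℤ.+ flow w
    prepend {u} e w uniq with u ∈? vertices w
    ... | no u∉w = e ◅ w , ¬Any⇒All¬ _ u∉w ∷ uniq , ≡.refl
    prepend e nil _ | yes (here ≡.refl) = contradiction e ~-irrefl
    prepend e (_ ◅ _) _ | yes (here ≡.refl) = contradiction e ~-irrefl
    prepend {u} {x} e (_◅_ {j = y} e′ w) (x∉w ∷ uniq) | yes (there u∈w) with u ≟ y
    ... | yes ≡.refl = w , uniq , ≡.sym (backtrack u x (flow w))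
    ... | no u≢y with initialSegment w uniq u∈w u≢y
    ...   | ws , linked , (u∉ws ∷ ws!) , ws⊆w =
      contradiction (e ∷ e′ ∷ linked)
        (~-acyclic u x y ws ((≡.≢-sym (All.lookup x∉w u∈w) ∷ u∉ws)
          ∷ All.tabulate (λ z∈ → All.lookup x∉w (ws⊆w z∈)) ∷ ws!))

    -- A closed walk erases to the trivial one, so flows are path independent.
    loopErasure : ∀ {u v} (w : Star _~_ u v) →
      Σ[ w′ ∈ Star _~_ u v ] Unique (vertices w′) × flow w′ ≡ flow w
    loopErasure nil = nil , [] ∷ [] , ≡.refl
    loopErasure (_◅_ {u} {x} e w) =
      let w′ , uniq , eq = loopErasure w
          w″ , uniq′ , eq′ = prepend e w′ uniq
      in w″ , uniq′ , ≡.trans eq′ (≡.cong (λ t → f u x ℤ.+ t) eq)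

    flow-closed : ∀ {u} (w : Star _~_ u u) → flow w ≡ 0ℤ
    flow-closed w with loopErasure w
    ... | nil , _ , eq = ≡.sym eq
    ... | e ◅ w′ , u∉w′ ∷ _ , _ = contradiction ≡.refl (All.lookup u∉w′ (target∈ w′))
      where
      target∈ : ∀ {u v} (w : Star _~_ u v) → v ∈ vertices w
      target∈ nil     = here ≡.refl
      target∈ (_ ◅ w) = there (target∈ w)

    flow-unique : ∀ {u v} (w w′ : Star _~_ u v) → flow w ≡ flow w′
    flow-unique w w′ with reversed w′
    ... | r , eq = ℤ.i-j≡0⇒i≡j _ _ (≡.trans (≡.cong (λ t → flow w ℤ.+ t) (≡.sym eq))
      (≡.trans (≡.sym (flow-◅◅ w r)) (flow-closed (w ◅◅ r))))

-- Integer functions on the nodes of a tree with numbered edges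

module TreePotentials {b r} {_~_ : Rel (Fin (ℕ.suc r)) b}
  (~-sym : ∀ {u v} → u ~ v → v ~ u) (~-irrefl : ∀ {u} → ¬ u ~ u)
  (~-acyclic : ∀ u v w ws → Unique (u ∷ v ∷ w ∷ ws) → ¬ Linked _~_ (u ∷ v ∷ w ∷ ws ++ [ u ]))
  (~-connected : ∀ u v → Star _~_ u v)
  {p q : Fin r → Fin (ℕ.suc r)} (p<q : ∀ i → p i Fin.< q i) (adjacent : ∀ i → p i ~ q i)
  (injective : ∀ i j → p i ≡ p j → q i ≡ q j → i ≡ j)
  (complete : ∀ a b → a Fin.< b → a ~ b → ∃[ i ] p i ≡ a × q i ≡ b)
  where

  open Walks Fin._≟_ ~-sym ~-irrefl ~-acyclic

  module Crossing (i : Fin r) where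

    -- The 1-cochain that is 1 along `ℓ_i` from `p i` to `q i`, -1 against it and 0 on all other
    -- edges. Written with products of `δ`, it is antisymmetric by ring arithmetic alone.
    crossing : Fin (ℕ.suc r) → Fin (ℕ.suc r) → ℤ
    crossing a b = δ a (p i) ℤ.* δ b (q i) ℤ.- δ b (p i) ℤ.* δ a (q i)

    crossing-anti : ∀ a b → crossing b a ≡ ℤ.- crossing a b
    crossing-anti a b = swap (δ a (p i) ℤ.* δ b (q i)) (δ b (p i) ℤ.* δ a (q i))
      where
      swap : ∀ x y → y ℤ.- x ≡ ℤ.- (x ℤ.- y)
      swap = solve-∀

    crossing-edge : ∀ j → crossing (p j) (q j) ≡ δ i j
    crossing-edge j = ≡.trans (≡.cong₂ ℤ._-_ first second) (ℤ.+-identityʳ (δ i j))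
      where
      first : δ (p j) (p i) ℤ.* δ (q j) (q i) ≡ δ i j
      first with i Fin.≟ j
      ... | yes ≡.refl = ≡.cong₂ ℤ._*_ (δ-refl (p j)) (δ-refl (q j))
      ... | no i≢j with p j Fin.≟ p i
      ...   | no  _     = ≡.refl
      ...   | yes pj≡pi = ≡.trans (ℤ.*-identityˡ _)
        (δ-≢ (λ qj≡qi → i≢j (injective i j (≡.sym pj≡pi) (≡.sym qj≡qi))))

      second : δ (q j) (p i) ℤ.* δ (p j) (q i) ≡ 0ℤ
      -- Edges are numbered from the smaller to the larger index, so none is the reverse of another.
      second with q j Fin.≟ p i
      ... | no  _     = ≡.refl
      ... | yes qj≡pi = ≡.trans (ℤ.*-identityˡ _) (δ-≢ λ pj≡qi →
        ℕ.<-asym (p<q i) (≡.subst₂ Fin._<_ pj≡qi qj≡pi (p<q j)))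

    open Flow crossing crossing-anti public

  open Crossing using (crossing; crossing-anti; crossing-edge; flow; flow-◅◅; flow-unique)

  h : Fin r → Fin (ℕ.suc r) → ℤ
  h i m = flow i (~-connected Fin.zero m)

  -- By path independence the walk to `q j` may be taken through `p j`, so the two flows differ by
  -- the crossing of `ℓ_j` alone.
  h-edge : ∀ i j → h i (q j) ℤ.- h i (p j) ≡ δ i j
  h-edge i j = begin
    h i (q j) ℤ.- h i (p j)                                  ≡⟨ ≡.cong (ℤ._- h i (p j))
      (≡.trans (flow-unique i (~-connected Fin.zero (q j)) (w ◅◅ adjacent j ◅ nil)) (flow-◅◅ i w (adjacent j ◅ nil))) ⟩
    h i (p j) ℤ.+ (crossing i (p j) (q j) ℤ.+ 0ℤ) ℤ.- h i (p j)
      ≡⟨ cancel (h i (p j)) (crossing i (p j) (q j)) ⟩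
    crossing i (p j) (q j)                                   ≡⟨ crossing-edge i j ⟩
    δ i j                                                    ∎
    where
    open ≡.≡-Reasoning
    w = ~-connected Fin.zero (p j)
    cancel : ∀ a c → a ℤ.+ (c ℤ.+ 0ℤ) ℤ.- a ≡ c
    cancel = solve-∀

  module _ (x : Fin (ℕ.suc r) → ℤ) where

    private
      d : Fin r → ℤ
      d i = x (q i) ℤ.- x (p i)

    step-edge : ∀ j → sumℤ (λ i → d i ℤ.* crossing i (p j) (q j)) ≡ d j
    step-edge j = begin
      sumℤ (λ i → d i ℤ.* crossing i (p j) (q j)) ≡⟨ sumℤ-single j (λ i i≢j →
        ≡.trans (≡.cong (d i ℤ.*_) (≡.trans (crossing-edge i j) (δ-≢ i≢j))) (ℤ.*-zeroʳ (d i))) ⟩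
      d j ℤ.* crossing j (p j) (q j)
        ≡⟨ ≡.cong (d j ℤ.*_) (≡.trans (crossing-edge j j) (δ-refl j)) ⟩
      d j ℤ.* 1ℤ                                  ≡⟨ ℤ.*-identityʳ (d j) ⟩
      d j                                         ∎
      where open ≡.≡-Reasoning

    step-up : ∀ {a b} → a Fin.< b → a ~ b → sumℤ (λ i → d i ℤ.* crossing i a b) ≡ x b ℤ.- x a
    step-up a<b e with complete _ _ a<b e
    ... | j , ≡.refl , ≡.refl = step-edge j

    step : ∀ {a b} → a ~ b → sumℤ (λ i → d i ℤ.* crossing i a b) ≡ x b ℤ.- x a
    step {a} {b} e with Fin.<-cmp a b
    ... | tri< a<b _ _    = step-up a<b e
    ... | tri≈ _ ≡.refl _ = contradiction e ~-irrefl
    ... | tri> _ _ b<a    = begin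
      sumℤ (λ i → d i ℤ.* crossing i a b)           ≡⟨ sumℤ-cong (λ i →
        ≡.trans (≡.cong (d i ℤ.*_) (crossing-anti i b a)) (minus (d i) (crossing i b a))) ⟩
      sumℤ (λ i → -1ℤ ℤ.* (d i ℤ.* crossing i b a)) ≡⟨ *-distribˡ-sumℤ -1ℤ (λ i → d i ℤ.* crossing i b a) ⟨
      -1ℤ ℤ.* sumℤ (λ i → d i ℤ.* crossing i b a)   ≡⟨ ≡.cong (-1ℤ ℤ.*_) (step-up b<a (~-sym e)) ⟩
      -1ℤ ℤ.* (x a ℤ.- x b)                         ≡⟨ flip (x a) (x b) ⟩
      x b ℤ.- x a                                   ∎
      where
      open ≡.≡-Reasoning
      minus : ∀ s c → s ℤ.* (ℤ.- c) ≡ -1ℤ ℤ.* (s ℤ.* c)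
      minus = solve-∀
      flip : ∀ s c → -1ℤ ℤ.* (s ℤ.- c) ≡ c ℤ.- s
      flip = solve-∀

    -- On each step only the term of the edge being crossed survives, so the sum accumulates the
    -- change of `x` along the walk.
    walk-expansion : ∀ {a b} (w : Star _~_ a b) → sumℤ (λ i → d i ℤ.* flow i w) ≡ x b ℤ.- x a
    walk-expansion {a} nil = ≡.trans (sumℤ-zero λ i → ℤ.*-zeroʳ (d i)) (≡.sym (ℤ.+-inverseʳ (x a)))
    walk-expansion {a} {b} (_◅_ {j = c} e w) = begin
      sumℤ (λ i → d i ℤ.* (crossing i a c ℤ.+ flow i w)) ≡⟨ sumℤ-cong (λ i →
        ℤ.*-distribˡ-+ (d i) (crossing i a c) (flow i w)) ⟩
      sumℤ (λ i → d i ℤ.* crossing i a c ℤ.+ d i ℤ.* flow i w)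
        ≡⟨ sumℤ-+ (λ i → d i ℤ.* crossing i a c) (λ i → d i ℤ.* flow i w) ⟩
      sumℤ (λ i → d i ℤ.* crossing i a c) ℤ.+ sumℤ (λ i → d i ℤ.* flow i w)
        ≡⟨ ≡.cong₂ ℤ._+_ (step e) (walk-expansion w) ⟩
      (x c ℤ.- x a) ℤ.+ (x b ℤ.- x c) ≡⟨ chain (x a) (x b) (x c) ⟩
      x b ℤ.- x a ∎
      where
      open ≡.≡-Reasoning
      chain : ∀ a b c → (c ℤ.- a) ℤ.+ (b ℤ.- c) ≡ b ℤ.- a
      chain = solve-∀

    -- Up to a constant, which `Δ` kills, every integer function on the nodes is a combination of
    -- the `h i` whose coefficients are its rises along the edges. Integrality of both factors gives
    -- the divisibility argument, and the same expansion yields the second half of the inverse.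
    Δ-expansion : ∀ k → sumℤ (λ i → d i ℤ.* Δ (h i) k) ≡ Δ x k
    Δ-expansion k = ≡.trans
      (sumℤ-cong λ i → ≡.trans (≡.cong (d i ℤ.*_) (split (h i (Fin.suc k)) (h i (inject₁ k))))
        (ℤ.*-distribˡ-+ (d i) (h i (Fin.suc k)) (-1ℤ ℤ.* h i (inject₁ k))))
      (≡.trans (sumℤ-+ (λ i → d i ℤ.* h i (Fin.suc k)) (λ i → d i ℤ.* (-1ℤ ℤ.* h i (inject₁ k))))
      (≡.trans (≡.cong₂ ℤ._+_ (walk-expansion (~-connected Fin.zero (Fin.suc k)))
        (≡.trans (sumℤ-cong λ i → swap (d i) (h i (inject₁ k)))
        (≡.trans (≡.sym (*-distribˡ-sumℤ -1ℤ (λ i → d i ℤ.* h i (inject₁ k))))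
          (≡.cong (-1ℤ ℤ.*_) (walk-expansion (~-connected Fin.zero (inject₁ k)))))))
        (difference (x (Fin.suc k)) (x (inject₁ k)) (x Fin.zero))))
      where
      split : ∀ a b → a ℤ.- b ≡ a ℤ.+ -1ℤ ℤ.* b
      split = solve-∀
      swap : ∀ a b → a ℤ.* (-1ℤ ℤ.* b) ≡ -1ℤ ℤ.* (a ℤ.* b)
      swap = solve-∀
      difference : ∀ a b c → (a ℤ.- c) ℤ.+ -1ℤ ℤ.* (b ℤ.- c) ≡ a ℤ.- b
      difference = solve-∀

-- Ordered fields

module RealProperties {c ℓ₁ ℓ₂} (ℝ : Reals c ℓ₁ ℓ₂) where

  open Reals ℝ
  open CommutativeRing commutativeRing using (ring)
  open RingProperties ring using (-‿distribˡ-*; -‿distribʳ-*; -‿involutive; -0#≈0#; -‿+-comm)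
  open SemiringMult semiring using (×-homo-+; ×-homo-1)
  open SemiringSum semiring using (sum-remove)
  open HCR heytingCommutativeRing using (1#0; #-congʳ; x-0≈x; invertibleˡ⇒#)
  module ≈-Reasoning = SetoidReasoning setoid

  fromℤ-⊖ : ∀ m n → fromℤ (m ℤ.⊖ n) ≈ fromℕ m - fromℕ n
  fromℤ-⊖ m ℕ.zero = sym (x-0≈x (fromℕ m))
  fromℤ-⊖ ℕ.zero (ℕ.suc n) = sym (+-identityˡ _)
  fromℤ-⊖ (ℕ.suc m) (ℕ.suc n) = begin
    fromℤ (ℕ.suc m ℤ.⊖ ℕ.suc n)               ≡⟨ ≡.cong fromℤ (ℤ.[1+m]⊖[1+n]≡m⊖n m n) ⟩
    fromℤ (m ℤ.⊖ n)                           ≈⟨ fromℤ-⊖ m n ⟩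
    fromℕ m - fromℕ n                         ≈⟨ +-congʳ (+-identityˡ (fromℕ m)) ⟨
    (0# + fromℕ m) - fromℕ n                  ≈⟨ +-congʳ (+-congʳ (-‿inverseˡ 1#)) ⟨
    ((- 1# + 1#) + fromℕ m) - fromℕ n         ≈⟨ +-congʳ (+-assoc (- 1#) 1# (fromℕ m)) ⟩
    (- 1# + fromℕ (ℕ.suc m)) - fromℕ n        ≈⟨ +-congʳ (+-comm (- 1#) _) ⟩
    (fromℕ (ℕ.suc m) - 1#) - fromℕ n          ≈⟨ +-assoc _ (- 1#) (- fromℕ n) ⟩
    fromℕ (ℕ.suc m) + (- 1# - fromℕ n)        ≈⟨ +-congˡ (-‿+-comm 1# (fromℕ n)) ⟩
    fromℕ (ℕ.suc m) - fromℕ (ℕ.suc n)         ∎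
    where open ≈-Reasoning

  fromℤ-neg : ∀ a → fromℤ (ℤ.- a) ≈ - fromℤ a
  fromℤ-neg (+ ℕ.zero)  = sym -0#≈0#
  fromℤ-neg (+ ℕ.suc n) = refl
  fromℤ-neg -[1+ n ]    = sym (-‿involutive _)

  fromℤ-+ : ∀ a b → fromℤ (a ℤ.+ b) ≈ fromℤ a + fromℤ b
  fromℤ-+ (+ m)    (+ n)    = ×-homo-+ 1# m n
  fromℤ-+ (+ m)    -[1+ n ] = fromℤ-⊖ m (ℕ.suc n)
  fromℤ-+ -[1+ m ] (+ n)    = trans (fromℤ-⊖ n (ℕ.suc m)) (+-comm _ _)
  fromℤ-+ -[1+ m ] -[1+ n ] = begin
    - fromℕ (ℕ.suc (ℕ.suc (m ℕ.+ n)))            ≡⟨ ≡.cong (λ k → - fromℕ (ℕ.suc k)) (ℕ.+-suc m n) ⟨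
    - fromℕ (ℕ.suc m ℕ.+ ℕ.suc n)                ≈⟨ -‿cong (×-homo-+ 1# (ℕ.suc m) (ℕ.suc n)) ⟩
    - (fromℕ (ℕ.suc m) + fromℕ (ℕ.suc n))        ≈⟨ -‿+-comm _ _ ⟨
    - fromℕ (ℕ.suc m) - fromℕ (ℕ.suc n)          ∎
    where open ≈-Reasoning

  private
    fromℤ-+* : ∀ m b → fromℤ (+ m ℤ.* b) ≈ fromℕ m * fromℤ b
    fromℤ-+* ℕ.zero b = trans (reflexive (≡.cong fromℤ (ℤ.*-zeroˡ b))) (sym (zeroˡ _))
    fromℤ-+* (ℕ.suc m) b = begin
      fromℤ (+ ℕ.suc m ℤ.* b)              ≡⟨ ≡.cong fromℤ (ℤ.suc-* (+ m) b) ⟩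
      fromℤ (b ℤ.+ + m ℤ.* b)              ≈⟨ fromℤ-+ b (+ m ℤ.* b) ⟩
      fromℤ b + fromℤ (+ m ℤ.* b)          ≈⟨ +-cong (sym (*-identityˡ _)) (fromℤ-+* m b) ⟩
      1# * fromℤ b + fromℕ m * fromℤ b     ≈⟨ distribʳ _ 1# (fromℕ m) ⟨
      fromℕ (ℕ.suc m) * fromℤ b            ∎
      where open ≈-Reasoning

  fromℤ-* : ∀ a b → fromℤ (a ℤ.* b) ≈ fromℤ a * fromℤ b
  fromℤ-* (+ m)    b = fromℤ-+* m b
  fromℤ-* -[1+ m ] b = begin
    fromℤ (-[1+ m ] ℤ.* b)        ≡⟨ ≡.cong fromℤ (ℤ.neg-distribˡ-* (+ ℕ.suc m) b) ⟨
    fromℤ (ℤ.- (+ ℕ.suc m ℤ.* b)) ≈⟨ fromℤ-neg (+ ℕ.suc m ℤ.* b) ⟩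
    - fromℤ (+ ℕ.suc m ℤ.* b)     ≈⟨ -‿cong (fromℤ-+* (ℕ.suc m) b) ⟩
    - (fromℕ (ℕ.suc m) * fromℤ b) ≈⟨ -‿distribˡ-* _ _ ⟩
    - fromℕ (ℕ.suc m) * fromℤ b   ∎
    where open ≈-Reasoning

  fromℤ-1 : fromℤ 1ℤ ≈ 1#
  fromℤ-1 = ×-homo-1 1#

  fromℤ-sub : ∀ a b → fromℤ (a ℤ.- b) ≈ fromℤ a - fromℤ b
  fromℤ-sub a b = trans (fromℤ-+ a (ℤ.- b)) (+-congˡ (fromℤ-neg b))

  fromℤ-sum : ∀ {n} (f : Vector ℤ n) →
    fromℤ (sumℤ f) ≈ sum (fromℤ ∘ f)
  fromℤ-sum {ℕ.zero}  f = refl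
  fromℤ-sum {ℕ.suc n} f = trans (fromℤ-+ (f Fin.zero) _) (+-congˡ (fromℤ-sum (f ∘ Fin.suc)))

  almostCommutativeRing = fromCommutativeRing commutativeRing

  fromℤ-morphism : ℤ.+-*-rawRing -Raw-AlmostCommutative⟶ almostCommutativeRing
  fromℤ-morphism = record
    { ⟦_⟧    = fromℤ
    ; +-homo = fromℤ-+
    ; *-homo = fromℤ-*
    ; -‿homo = fromℤ-neg
    ; 0-homo = refl
    ; 1-homo = fromℤ-1
    }

  private
    coeff≟ : ∀ a b → Maybe (fromℤ a ≈ fromℤ b)
    coeff≟ a b with a ℤ.≟ b
    ... | yes ≡.refl = just refl
    ... | no _       = nothing

  module Solver = RingSolver ℤ.+-*-rawRing almostCommutativeRing fromℤ-morphism coeff≟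

  open IsStrictPartialOrder isStrictPartialOrder using ()
    renaming (irrefl to <-irrefl; trans to <-trans; <-respʳ-≈ to <-respʳ; <-respˡ-≈ to <-respˡ) public

  -- Takes the place of trichotomy; inherited from cotransitivity of apartness.
  <-cotrans : ∀ {x y} → x < y → ∀ z → x < z ⊎ z < y
  <-cotrans x<y z with #-cotrans (<⇒# x<y) z
  <-cotrans x<y z | inj₁ x#z with #⇒<⊎> x#z
  ... | inj₁ x<z = inj₁ x<z
  ... | inj₂ z<x = inj₂ (<-trans z<x x<y)
  <-cotrans x<y z | inj₂ z#y with #⇒<⊎> z#y
  ... | inj₁ z<y = inj₂ z<y
  ... | inj₂ y<z = inj₁ (<-trans x<y y<z)

  <-resp : ∀ {x x′ y y′} → x ≈ x′ → y ≈ y′ → x < y → x′ < y′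
  <-resp x≈x′ y≈y′ x<y = <-respˡ x≈x′ (<-respʳ y≈y′ x<y)

  x<y⇒0<y-x : ∀ {x y} → x < y → 0# < y - x
  x<y⇒0<y-x {x} x<y = <-respˡ (-‿inverseʳ x) (+-monoˡ-< (- x) x<y)

  0<y-x⇒x<y : ∀ {x y} → 0# < y - x → x < y
  0<y-x⇒x<y {x} {y} 0<y-x = <-resp (+-identityˡ x)
    (solve 2 (λ x y → (y :- x) :+ x := y) refl x y) (+-monoˡ-< x 0<y-x)
    where open Solver

  0<1 : 0# < 1#
  0<1 with #⇒<⊎> 1#0
  ... | inj₂ 0<1 = 0<1
  ... | inj₁ 1<0 = contradiction (<-trans 1<0 (<-respʳ
    (solve 0 ((:- con 1ℤ) :* (:- con 1ℤ) := con 1ℤ) refl) (*-pos 0<-1 0<-1))) (<-irrefl fromℤ-1′)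
    where
    open Solver
    -- `con 1ℤ` denotes `fromℤ 1ℤ`, which computes to `1# + 0#` and not to `1#`.
    fromℤ-1′ = sym fromℤ-1
    0<-1 : 0# < - fromℤ 1ℤ
    0<-1 = <-resp (-‿inverseʳ 1#) (trans (+-identityˡ _) (-‿cong fromℤ-1′)) (+-monoˡ-< (- 1#) 1<0)

  -- Cotransitivity of `0# < y` at `x + y` leaves one other case, `x + y < y`, which would make `x`
  -- negative.
  +-pos : ∀ {x y} → 0# ≤ x → 0# < y → 0# < x + y
  +-pos {x} {y} 0≤x 0<y with <-cotrans 0<y (x + y)
  ... | inj₁ 0<x+y = 0<x+y
  ... | inj₂ x+y<y = contradiction
    (<-resp (solve 2 (λ x y → (x :+ y) :- y := x) refl x y) (-‿inverseʳ y) (+-monoˡ-< (- y) x+y<y)) 0≤x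
    where open Solver

  <⇒≤ : ∀ {x y} → x < y → x ≤ y
  <⇒≤ x<y y<x = <-irrefl refl (<-trans x<y y<x)

  -- In a Heyting field apartness from `0#` is invertibility, and a factor of an invertible element
  -- is invertible. The terms `x - 0#` arise because invertibility is stated for differences.
  *-#⇒# : ∀ {x y} → x * y # 0# → x # 0#
  *-#⇒# {x} {y} xy#0 with #⇒invertible xy#0
  ... | i , i*xy≈1 , _ = invertibleˡ⇒# (i * y , trans
    (solve 3 (λ i x y → i :* y :* (x :- con 0ℤ) := i :* (x :* y :- con 0ℤ)) refl i x y) i*xy≈1)
    where open Solver

  +-#⇒# : ∀ {x y} → x + y # 0# → x # 0# ⊎ y # 0#
  +-#⇒# {x} {y} x+y#0 with #-cotrans x+y#0 y
  ... | inj₂ y#0   = inj₂ y#0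
  ... | inj₁ x+y#y with #⇒invertible x+y#y
  ...   | i , i*x≈1 , _ = inj₁ (invertibleˡ⇒# (i , trans
    (solve 3 (λ i x y → i :* (x :- con 0ℤ) := i :* ((x :+ y) :- y)) refl i x y) i*x≈1))
    where open Solver

  #0∧0≤⇒0< : ∀ {x} → x # 0# → 0# ≤ x → 0# < x
  #0∧0≤⇒0< x#0 0≤x with #⇒<⊎> x#0
  ... | inj₁ x<0 = contradiction x<0 0≤x
  ... | inj₂ 0<x = 0<x

  -- Since `≤` is a negated `<`, a negative product may be assumed. It makes both factors apart from
  -- `0#`, hence positive, and so the product positive.
  *-nonneg : ∀ {x y} → 0# ≤ x → 0# ≤ y → 0# ≤ x * y
  *-nonneg {x} {y} 0≤x 0≤y xy<0 = <⇒≤ (*-pos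
    (#0∧0≤⇒0< (*-#⇒# (<⇒# xy<0)) 0≤x)
    (#0∧0≤⇒0< (*-#⇒# (<⇒# (<-respˡ (*-comm x y) xy<0))) 0≤y)) xy<0

  sum-pos : ∀ {n} {f : Vector Carrier n} → (∀ k → 0# ≤ f k) → ∀ k → 0# < f k → 0# < sum f
  sum-pos {ℕ.suc n} {f} 0≤f k 0<fk = <-respʳ
    (trans (+-comm _ _) (sym (sum-remove {i = k} f)))
    (+-pos (sum-nonneg λ j → 0≤f (Fin.punchIn k j)) 0<fk)
    where
    sum-nonneg : ∀ {n} {f : Vector Carrier n} → (∀ k → 0# ≤ f k) → 0# ≤ sum f
    sum-nonneg {ℕ.zero} 0≤f = <-irrefl refl
    sum-nonneg {ℕ.suc n} {f} 0≤f Σ<0 with <-cotrans Σ<0 (f Fin.zero)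
    ... | inj₁ Σ<f0 = sum-nonneg (0≤f ∘ Fin.suc)
      (<-resp (solve 2 (λ x y → (x :+ y) :- x := y) refl _ _) (-‿inverseʳ _) (+-monoˡ-< (- f Fin.zero) Σ<f0))
      where open Solver
    ... | inj₂ f0<0 = 0≤f Fin.zero f0<0

  -- Locates a nonzero summand without deciding equality of reals; this is how a column is found for
  -- each row of `N`.
  sum-# : ∀ {n} {f : Vector Carrier n} → sum f # 0# → ∃[ k ] f k # 0#
  sum-# {ℕ.zero}  0#0 = contradiction 0#0 (#-irrefl refl)
  sum-# {ℕ.suc n} Σ#0 with +-#⇒# Σ#0
  ... | inj₁ f0#0 = Fin.zero , f0#0
  ... | inj₂ Σ′#0 with sum-# Σ′#0
  ...   | k , fk#0 = Fin.suc k , fk#0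

  fromℤ-pos : ∀ {a} → 0ℤ ℤ.< a → 0# < fromℤ a
  fromℤ-pos {+ ℕ.suc n} _ = fromℕ-pos n
    where
    fromℕ-pos : ∀ n → 0# < fromℕ (ℕ.suc n)
    fromℕ-pos ℕ.zero    = <-respʳ (sym fromℤ-1) 0<1
    fromℕ-pos (ℕ.suc n) = +-pos (<⇒≤ 0<1) (fromℕ-pos n)
  fromℤ-pos {+ ℕ.zero} (ℤ.+<+ ())

  fromℤ-mono-< : ∀ {a b} → a ℤ.< b → fromℤ a < fromℤ b
  fromℤ-mono-< {a} {b} a<b = 0<y-x⇒x<y (<-respʳ (fromℤ-sub b a)
    (fromℤ-pos (≡.subst (ℤ._< b ℤ.- a) (ℤ.+-inverseʳ a) (ℤ.+-monoˡ-< (ℤ.- a) a<b))))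

  fromℤ-cancel-< : ∀ {a b} → fromℤ a < fromℤ b → a ℤ.< b
  fromℤ-cancel-< {a} {b} a<b with ℤ.<-cmp a b
  ... | tri< a<b′ _ _      = a<b′
  ... | tri≈ _ ≡.refl _    = contradiction a<b (<-irrefl refl)
  ... | tri> _ _ b<a       = contradiction a<b (<⇒≤ (fromℤ-mono-< b<a))

  fromℤ-nonneg : ∀ {a} → 0ℤ ℤ.≤ a → 0# ≤ fromℤ a
  fromℤ-nonneg 0≤a a<0 = ℤ.≤⇒≯ 0≤a (fromℤ-cancel-< a<0)

  fromℤ-injective : ∀ {a b} → fromℤ a ≈ fromℤ b → a ≡ b
  fromℤ-injective {a} {b} eq with ℤ.<-cmp a b
  ... | tri< a<b _ _  = contradiction (fromℤ-mono-< a<b) (<-irrefl eq)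
  ... | tri≈ _ a≡b _  = a≡b
  ... | tri> _ _ b<a  = contradiction (fromℤ-mono-< b<a) (<-irrefl (sym eq))

  *-cancel-pos : ∀ {x y} → 0# < x → 0# < x * y → 0# < y
  *-cancel-pos {x} {y} 0<x 0<xy = #0∧0≤⇒0<
    (*-#⇒# (#-congʳ (*-comm x y) (#-sym (<⇒# 0<xy))))
    λ y<0 → <⇒≤ 0<xy (0<y-x⇒x<y (<-respʳ x[0-y]≈0-xy (*-pos 0<x (x<y⇒0<y-x y<0))))
    where
    x[0-y]≈0-xy : x * (0# - y) ≈ 0# - x * y
    x[0-y]≈0-xy = trans (*-congˡ (+-identityˡ (- y))) (trans (sym (-‿distribʳ-* x y)) (sym (+-identityˡ (- (x * y)))))

  inverse-pos : ∀ {x} → 0# < x → ∃[ y ] 0# < y × x * y ≈ 1#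
  inverse-pos {x} 0<x with #⇒invertible (#-sym (<⇒# 0<x))
  ... | y , _ , [x-0]*y≈1 = y , *-cancel-pos 0<x (<-respʳ (sym x*y≈1) 0<1) , x*y≈1
    where
    x*y≈1 : x * y ≈ 1#
    x*y≈1 = trans (*-congʳ (sym (x-0≈x x))) [x-0]*y≈1

-- The closed region and the cone

bound : ∀ {n} (w : Vector ℤ n) → ∃[ B ] (∀ m → ℤ.∣ w m ∣ ℕ.< B)
bound {ℕ.zero}  w = 0 , λ ()
bound {ℕ.suc n} w with bound (w ∘ Fin.suc)
... | B , w<B = ℕ.suc ℤ.∣ w Fin.zero ∣ ℕ.+ B , λ
  { Fin.zero    → ℕ.m≤m+n _ B
  ; (Fin.suc m) → ℕ.≤-trans (w<B m) (ℕ.m≤n+m B _) }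

∣i∣<n⇒i<n : ∀ i {n} → ℤ.∣ i ∣ ℕ.< n → i ℤ.< + n
∣i∣<n⇒i<n (+ _)    i<n = ℤ.+<+ i<n
∣i∣<n⇒i<n -[1+ _ ] _   = ℤ.-<+

◃-square : ∀ (s : Sign) → (s ◃ 1) ℤ.* (s ◃ 1) ≡ 1ℤ
◃-square Sign.+ = ≡.refl
◃-square Sign.- = ≡.refl

module Approximation {c ℓ₁ ℓ₂} (ℝ : Reals c ℓ₁ ℓ₂) where

  open Reals ℝ
  open RealProperties ℝ
  open CommutativeRing commutativeRing using (ring)
  open SemiringSum semiring using (sum-cong-≋; *-distribˡ-sum; ∑-distrib-+)
  open SumLemmas semiring
  open RingProperties ring using (-1*x≈-x; x[y-z]≈xy-xz)

  -- The factor 2 absorbs the two errors: distinct even integers differ by at least 2.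
  within-≤ : ∀ {a b x y} → Within 1# (fromℤ (+ 2 ℤ.* a)) x → Within 1# (fromℤ (+ 2 ℤ.* b)) y →
    x < y → a ℤ.≤ b
  within-≤ {a} {b} {x} {y} (_ , a-x<1) (-1<b-y , _) x<y =
    ≡.subst (a ℤ.≤_) (ℤ.pred-suc b) (ℤ.i<j⇒i≤pred[j] {a} {ℤ.suc b}
      (ℤ.*-cancelˡ-<-nonNeg {a} {ℤ.suc b} (+ 2) (fromℤ-cancel-< (0<y-x⇒x<y (<-respʳ total
        (+-pos (<⇒≤ (+-pos (<⇒≤ (x<y⇒0<y-x a-x<1)) (x<y⇒0<y-x -1<b-y))) (x<y⇒0<y-x x<y)))))))
    where
    open Solver
    double-suc : ∀ b → + 2 ℤ.* b ℤ.+ + 2 ≡ + 2 ℤ.* (1ℤ ℤ.+ b)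
    double-suc = solve-∀
    A = fromℤ (+ 2 ℤ.* a)
    B = fromℤ (+ 2 ℤ.* b)
    -- The slacks of the two approximations and `y - x` are all positive and add up to
    -- `2 (b + 1) - 2 a`. In the solver call, `o :+ (o :+ con 0ℤ)` is `fromℤ (+ 2)` unfolded.
    total : 1# - (A - x) + ((B - y) - - 1#) + (y - x) ≈ fromℤ (+ 2 ℤ.* ℤ.suc b) - A
    total = trans
      (solve 5 (λ o A B x y → o :- (A :- x) :+ ((B :- y) :- (:- o)) :+ (y :- x)
        := (B :+ (o :+ (o :+ con 0ℤ))) :- A) refl 1# A B x y)
      (+-congʳ (trans (sym (fromℤ-+ (+ 2 ℤ.* b) (+ 2))) (reflexive (≡.cong fromℤ (double-suc b)))))

  module Region {r} (p q : Fin r → Fin (ℕ.suc r)) (s : Fin r → Sign) where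

    region : Pred (Vector Carrier (ℕ.suc r)) _
    region x = ∀ l → 0# < fromℤ (s l ◃ 1) * (x (q l) - x (p l))

    closure⇒nonneg : ∀ (X : Vector ℤ (ℕ.suc r)) → closure ℝ region (λ m → fromℤ (+ 2 ℤ.* X m)) →
      ∀ l → 0ℤ ℤ.≤ (s l ◃ 1) ℤ.* (X (q l) ℤ.- X (p l))
    closure⇒nonneg X X∈ l = signed (s l) (y∈ l)
      where
      approximation = X∈ 1# 0<1
      y    = proj₁ approximation
      y∈   = proj₁ (proj₂ approximation)
      near = proj₂ (proj₂ approximation)
      signed : ∀ σ → 0# < fromℤ (σ ◃ 1) * (y (q l) - y (p l)) →
        0ℤ ℤ.≤ (σ ◃ 1) ℤ.* (X (q l) ℤ.- X (p l))
      signed Sign.+ pos = ≡.subst (0ℤ ℤ.≤_) (≡.sym (ℤ.*-identityˡ _)) (ℤ.i≤j⇒0≤j-i {X (p l)} {X (q l)}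
        (within-≤ {X (p l)} {X (q l)} (near (p l)) (near (q l))
          (0<y-x⇒x<y (<-respʳ (trans (*-congʳ fromℤ-1) (*-identityˡ _)) pos))))
      signed Sign.- pos = ≡.subst (0ℤ ℤ.≤_) (flip (X (q l)) (X (p l))) (ℤ.i≤j⇒0≤j-i {X (q l)} {X (p l)}
        (within-≤ {X (q l)} {X (p l)} (near (q l)) (near (p l))
          (0<y-x⇒x<y (<-respʳ
            (solve 2 (λ a b → con -1ℤ :* (a :- b) := b :- a) refl (y (q l)) (y (p l))) pos))))
        where
        open Solver
        flip : ∀ a b → b ℤ.- a ≡ -1ℤ ℤ.* (a ℤ.- b)
        flip = solve-∀

    -- For every η > 0 the point X + η w lies in the open region.
    nonneg⇒closure : ∀ (w X : Vector ℤ (ℕ.suc r)) →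
      (∀ l → (s l ◃ 1) ℤ.* (w (q l) ℤ.- w (p l)) ≡ 1ℤ) →
      (∀ l → 0ℤ ℤ.≤ (s l ◃ 1) ℤ.* (X (q l) ℤ.- X (p l))) →
      closure ℝ region (fromℤ ∘ X)
    nonneg⇒closure w X w-interior X-nonneg e 0<e =
      (λ m → fromℤ (X m) + η * fromℤ (w m)) , inRegion , near
      where
      open Solver
      B   = proj₁ (bound w)
      w<B = proj₂ (bound w)
      0<B : 0# < fromℤ (+ B)
      0<B = fromℤ-pos (ℤ.+<+ (ℕ.≤-<-trans ℕ.z≤n (w<B Fin.zero)))
      B⁻¹     = proj₁ (inverse-pos 0<B)
      0<B⁻¹   = proj₁ (proj₂ (inverse-pos 0<B))
      B*B⁻¹≈1 = proj₂ (proj₂ (inverse-pos 0<B))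
      -- As `B` exceeds every `∣ w m ∣`, this keeps each displacement `η * w m` strictly within `e`.
      η = e * B⁻¹
      0<η : 0# < η
      0<η = *-pos 0<e 0<B⁻¹
      inRegion : ∀ l → 0# < fromℤ (s l ◃ 1) *
        ((fromℤ (X (q l)) + η * fromℤ (w (q l))) - (fromℤ (X (p l)) + η * fromℤ (w (p l))))
      inRegion l = <-respʳ
        (trans (+-cong (fromℤ-slope X) (trans (sym (*-identityʳ η)) (*-congˡ
            (trans (sym fromℤ-1) (trans (reflexive (≡.cong fromℤ (≡.sym (w-interior l)))) (fromℤ-slope w))))))
          (solve 6 (λ σ a b c d η → σ :* (a :- b) :+ η :* (σ :* (c :- d)) :=
            σ :* ((a :+ η :* c) :- (b :+ η :* d))) refl
            (fromℤ (s l ◃ 1)) (fromℤ (X (q l))) (fromℤ (X (p l))) (fromℤ (w (q l))) (fromℤ (w (p l))) η))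
        (+-pos (fromℤ-nonneg (X-nonneg l)) 0<η)
        where
        fromℤ-slope : ∀ (Y : Vector ℤ (ℕ.suc r)) → fromℤ ((s l ◃ 1) ℤ.* (Y (q l) ℤ.- Y (p l))) ≈
          fromℤ (s l ◃ 1) * (fromℤ (Y (q l)) - fromℤ (Y (p l)))
        fromℤ-slope Y = trans (fromℤ-* (s l ◃ 1) (Y (q l) ℤ.- Y (p l))) (*-congˡ (fromℤ-sub (Y (q l)) (Y (p l))))
      ηB≈e : η * fromℤ (+ B) ≈ e
      ηB≈e = trans (solve 3 (λ e i b → (e :* i) :* b := e :* (b :* i)) refl e B⁻¹ (fromℤ (+ B)))
        (trans (*-congˡ B*B⁻¹≈1) (*-identityʳ e))
      η*<e : ∀ {i} → ℤ.∣ i ∣ ℕ.< B → η * fromℤ i < e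
      η*<e {i} i<B = 0<y-x⇒x<y (<-respʳ
        (trans (solve 3 (λ η b i → η :* (b :- i) := η :* b :- η :* i) refl η (fromℤ (+ B)) (fromℤ i))
          (+-congʳ ηB≈e))
        (*-pos 0<η (x<y⇒0<y-x (fromℤ-mono-< (∣i∣<n⇒i<n i i<B)))))
      near : ∀ m → Within e (fromℤ (X m)) (fromℤ (X m) + η * fromℤ (w m))
      near m =
        0<y-x⇒x<y (<-respʳ
          (solve 3 (λ e a b → e :- b := (a :- (a :+ b)) :- (:- e)) refl e (fromℤ (X m)) (η * fromℤ (w m)))
          (x<y⇒0<y-x (η*<e {w m} (w<B m)))) ,
        <-respˡ
          (trans (*-congˡ (fromℤ-neg (w m)))
            (solve 3 (λ η a b → η :* (:- b) := a :- (a :+ η :* b)) refl η (fromℤ (X m)) (fromℤ (w m))))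
          (η*<e {ℤ.- w m} (≡.subst (ℕ._< B) (≡.sym (ℤ.∣-i∣≡∣i∣ (w m))) (w<B m)))

  -- The kernel of `F` is the line of constant vectors, and `clusterRegion` constrains a point only
  -- through `F`.
  differences-determine : ∀ {r} (x u : Vector Carrier (ℕ.suc r)) →
    (∀ j → differences ℝ x j ≈ differences ℝ u j) → ∀ m → x m - u m ≈ x Fin.zero - u Fin.zero
  differences-determine x u Δx≈Δu Fin.zero = refl
  differences-determine {ℕ.suc r} x u Δx≈Δu (Fin.suc m) =
    trans (differences-determine (x ∘ Fin.suc) (u ∘ Fin.suc) (Δx≈Δu ∘ Fin.suc) m)
      (trans (solve 4 (λ a b c d → a :- b := (a :- c) :+ (c :- b)) refl
          (x (Fin.suc Fin.zero)) (u (Fin.suc Fin.zero)) (x Fin.zero) (u Fin.zero))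
        (trans (+-congʳ (Δx≈Δu Fin.zero))
          (solve 4 (λ a b c d → (b :- d) :+ (c :- b) := c :- d) refl
            (x (Fin.suc Fin.zero)) (u (Fin.suc Fin.zero)) (x Fin.zero) (u Fin.zero))))
    where open Solver

  module Cone {r} (ε : Vector Sign (ℕ.suc r)) (v : Vector (Vector ℤ r) r) where

    E = eulerMatrix ε

    Y : Fin r → Vector ℤ (ℕ.suc r)
    Y k = potential (v k ⊡ E)

    -- The generator is doubled because `closure⇒nonneg` takes points with even coordinates; its
    -- cone coefficients are `2 δ k i`.
    generator∈ : ∀ k → clusterRegion ℝ ε v (λ m → fromℤ (+ 2 ℤ.* Y k m))
    generator∈ k = (λ m → fromℤ (+ 2 ℤ.* v k m)) ,
      ((λ i → fromℤ (+ 2 ℤ.* δ k i)) , (λ i → fromℤ-nonneg (ℤ.*-monoˡ-≤-nonNeg (+ 2) (δ-nonneg k i))) , combination) , Δ-image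
      where
      combination : ∀ m → fromℤ (+ 2 ℤ.* v k m) ≈ sum (λ i → fromℤ (+ 2 ℤ.* δ k i) * fromℤ (v i m))
      combination m = sym (trans
        (sum-single k λ i i≢k → trans
          (*-congʳ (reflexive (≡.cong (λ d → fromℤ (+ 2 ℤ.* d)) (δ-≢ (i≢k ∘ ≡.sym))))) (zeroˡ _))
        (trans (*-congʳ (reflexive (≡.cong (λ d → fromℤ (+ 2 ℤ.* d)) (δ-refl k))))
          (sym (fromℤ-* (+ 2) (v k m)))))
      Δ-image : ∀ j → differences ℝ (λ m → fromℤ (+ 2 ℤ.* Y k m)) j ≈
        sum (λ l → fromℤ (E l j) * fromℤ (+ 2 ℤ.* v k l))
      Δ-image j = trans (sym (fromℤ-sub (+ 2 ℤ.* Y k (Fin.suc j)) (+ 2 ℤ.* Y k (inject₁ j))))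
        (trans (reflexive (≡.cong fromℤ integral))
        (trans (fromℤ-sum (λ l → E l j ℤ.* (+ 2 ℤ.* v k l)))
          (sum-cong-≋ λ l → fromℤ-* (E l j) (+ 2 ℤ.* v k l))))
        where
        open ≡.≡-Reasoning
        factor : ∀ a b → + 2 ℤ.* a ℤ.- + 2 ℤ.* b ≡ + 2 ℤ.* (a ℤ.- b)
        factor = solve-∀
        rotate : ∀ a b → + 2 ℤ.* (a ℤ.* b) ≡ b ℤ.* (+ 2 ℤ.* a)
        rotate = solve-∀
        integral : + 2 ℤ.* Y k (Fin.suc j) ℤ.- + 2 ℤ.* Y k (inject₁ j) ≡
          sumℤ (λ l → E l j ℤ.* (+ 2 ℤ.* v k l))
        integral = begin
          + 2 ℤ.* Y k (Fin.suc j) ℤ.- + 2 ℤ.* Y k (inject₁ j) ≡⟨ factor (Y k (Fin.suc j)) (Y k (inject₁ j)) ⟩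
          + 2 ℤ.* Δ (Y k) j                      ≡⟨ ≡.cong (+ 2 ℤ.*_) (Δ-potential (v k ⊡ E) j) ⟩
          + 2 ℤ.* (v k ⊡ E) j                    ≡⟨ *-distribˡ-sumℤ (+ 2) (λ l → v k l ℤ.* E l j) ⟩
          sumℤ (λ l → + 2 ℤ.* (v k l ℤ.* E l j)) ≡⟨ sumℤ-cong (λ l → rotate (v k l) (E l j)) ⟩
          sumℤ (λ l → E l j ℤ.* (+ 2 ℤ.* v k l)) ∎

    -- The combination `u` of the `Y k` with the cone coefficients of `x` has the same image under
    -- `F` as `x`, so `x` and `u` differ by a constant.
    coordinates : ∀ {x} → clusterRegion ℝ ε v x → Σ[ a ∈ Vector Carrier r ] (∀ k → 0# ≤ a k) ×
      (∀ p q → x q - x p ≈ sum (λ k → a k * fromℤ (Y k q ℤ.- Y k p)))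
    coordinates {x} (s , (a , a≥0 , s≈) , Δx≈) = a , a≥0 , λ p q → begin
      x q - x p                             ≈⟨ solve 4 (λ a b c d → a :- b := ((a :- c) :- (b :- d)) :+ (c :- d))
                                                 refl (x q) (x p) (u q) (u p) ⟩
      ((x q - u q) - (x p - u p)) + (u q - u p) ≈⟨ +-congʳ (+-cong (Δ-det q) (-‿cong (Δ-det p))) ⟩
      ((x Fin.zero - u Fin.zero) - (x Fin.zero - u Fin.zero)) + (u q - u p)
                                            ≈⟨ trans (+-congʳ (-‿inverseʳ _)) (+-identityˡ _) ⟩
      u q - u p                             ≈⟨ u-difference p q ⟩
      sum (λ k → a k * fromℤ (Y k q ℤ.- Y k p)) ∎
      where
      open ≈-Reasoning
      open Solver using (solve; _:=_; _:-_; _:+_; _:*_)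
      u : Vector Carrier (ℕ.suc r)
      u m = sum (λ k → a k * fromℤ (Y k m))
      u-difference : ∀ p q → u q - u p ≈ sum (λ k → a k * fromℤ (Y k q ℤ.- Y k p))
      u-difference p q = begin
        u q - u p                                                        ≈⟨ +-congˡ (-1*x≈-x (u p)) ⟨
        u q + - 1# * u p                                                 ≈⟨ +-congˡ (*-distribˡ-sum (- 1#) (λ k → a k * fromℤ (Y k p))) ⟩
        u q + sum (λ k → - 1# * (a k * fromℤ (Y k p)))                   ≈⟨ ∑-distrib-+ (λ k → a k * fromℤ (Y k q)) (λ k → - 1# * (a k * fromℤ (Y k p))) ⟨
        sum (λ k → a k * fromℤ (Y k q) + - 1# * (a k * fromℤ (Y k p)))   ≈⟨ sum-cong-≋ (λ k →
          trans (+-congˡ (-1*x≈-x _)) (trans (sym (x[y-z]≈xy-xz (a k) _ _))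
            (*-congˡ (sym (fromℤ-sub (Y k q) (Y k p)))))) ⟩
        sum (λ k → a k * fromℤ (Y k q ℤ.- Y k p))                        ∎
      Δ-det : ∀ m → x m - u m ≈ x Fin.zero - u Fin.zero
      Δ-det = differences-determine x u λ j → begin
        differences ℝ x j                                   ≈⟨ Δx≈ j ⟩
        sum (λ l → fromℤ (E l j) * s l)                     ≈⟨ sum-cong-≋ (λ l →
          trans (*-comm _ _) (*-congʳ (s≈ l))) ⟩
        sum (λ l → sum (λ k → a k * fromℤ (v k l)) * fromℤ (E l j))
          ≈⟨ *-sum-sum a (λ l → fromℤ (E l j)) (λ k l → fromℤ (v k l)) ⟨
        sum (λ k → a k * sum (λ l → fromℤ (v k l) * fromℤ (E l j)))
          ≈⟨ sum-cong-≋ (λ k → *-congˡ (trans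
            (trans (sum-cong-≋ λ l → sym (fromℤ-* (v k l) (E l j))) (sym (fromℤ-sum (λ l → v k l ℤ.* E l j))))
            (reflexive (≡.cong fromℤ (≡.sym (Δ-potential (v k ⊡ E) j)))))) ⟩
        sum (λ k → a k * fromℤ (Δ (Y k) j))                 ≈⟨ u-difference (inject₁ j) (Fin.suc j) ⟨
        differences ℝ u j                                   ∎

-- Almost positive roots

β-inside : ∀ {r} {p q : Fin (ℕ.suc r)} {j : Fin r} → toℕ p ℕ.≤ toℕ j → toℕ j ℕ.< toℕ q → β p q j ≡ 1ℤ
β-inside {p = p} {q} {j} p≤j j<q = ≡.cong₂ (λ a b → if a ∧ b then 1ℤ else 0ℤ)
  (dec-true (toℕ p ℕ.≤? toℕ j) p≤j) (dec-true (toℕ j ℕ.<? toℕ q) j<q)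

β-outside : ∀ {r} {p q : Fin (ℕ.suc r)} {j : Fin r} → ¬ (toℕ p ℕ.≤ toℕ j × toℕ j ℕ.< toℕ q) → β p q j ≡ 0ℤ
β-outside {p = p} {q} {j} outside = helper (toℕ p ℕ.≤? toℕ j)
  where
  helper : Dec (toℕ p ℕ.≤ toℕ j) → β p q j ≡ 0ℤ
  helper (no p≰j)  = ≡.cong (λ a → if a ∧ does (toℕ j ℕ.<? toℕ q) then 1ℤ else 0ℤ)
    (dec-false (toℕ p ℕ.≤? toℕ j) p≰j)
  helper (yes p≤j) = ≡.trans
    (≡.cong (λ b → if does (toℕ p ℕ.≤? toℕ j) ∧ b then 1ℤ else 0ℤ)
      (dec-false (toℕ j ℕ.<? toℕ q) (λ j<q → outside (p≤j , j<q))))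
    (≡.cong (if_then 1ℤ else 0ℤ) (∧-zeroʳ (does (toℕ p ℕ.≤? toℕ j))))

module _ {r} (ε : Vector Sign (ℕ.suc r)) where

  private
    E = eulerMatrix ε

  euler-diagonal : ∀ i → E i i ≡ 1ℤ
  euler-diagonal i = ≡.cong (if_then 1ℤ else (if does (arrow? ε i i) then -1ℤ else 0ℤ)) (dec-true (i Fin.≟ i) ≡.refl)

  euler-off-diagonal : ∀ {i j} → i ≢ j → ¬ Arrow ε i j → E i j ≡ 0ℤ
  euler-off-diagonal {i} {j} i≢j ¬i→j = ≡.trans
    (≡.cong (if_then 1ℤ else (if does (arrow? ε i j) then -1ℤ else 0ℤ)) (dec-false (i Fin.≟ j) i≢j))
    (≡.cong (if_then -1ℤ else 0ℤ) (dec-false (arrow? ε i j) ¬i→j))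

  Between : Fin (ℕ.suc r) → Fin (ℕ.suc r) → Fin r → Set
  Between p q j = toℕ p ℕ.≤ toℕ j × toℕ j ℕ.< toℕ q

  -- Walks up from j, which receives no arrow from below, until no arrow enters
  -- from above either; n bounds the number of steps.
  source : ∀ {p q} n j → toℕ j ℕ.+ n ≡ toℕ q → Between p q j →
    (∀ k → Between p q k → toℕ k ℕ.< toℕ j → ¬ Arrow ε k j) →
    ∃[ i ] Between p q i × (∀ k → Between p q k → ¬ Arrow ε k i)
  source {p} {q} ℕ.zero j j+n≡q (_ , j<q) _ =
    contradiction (≡.trans (≡.sym (ℕ.+-identityʳ (toℕ j))) j+n≡q) (ℕ.<⇒≢ j<q)
  source {p} {q} (ℕ.suc n) j j+n≡q (p≤j , j<q) no-arrow with ε (Fin.suc j) in εj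
  ... | Sign.- = j , (p≤j , j<q) , λ k k∈ → λ
    { (inj₁ (j≡1+k , εk)) → no-arrow k k∈ (ℕ.≤-reflexive (≡.sym j≡1+k)) (inj₁ (j≡1+k , εk))
    ; (inj₂ (_ , εj≡+)) → contradiction (≡.trans (≡.sym εj) εj≡+) λ () }
  ... | Sign.+ with ℕ.suc (toℕ j) ℕ.<? toℕ q
  ...   | no 1+j≮q = j , (p≤j , j<q) , λ k k∈ → λ
    { (inj₁ (j≡1+k , εk)) → no-arrow k k∈ (ℕ.≤-reflexive (≡.sym j≡1+k)) (inj₁ (j≡1+k , εk))
    ; (inj₂ (k≡1+j , _))  → 1+j≮q (≡.subst (ℕ._< toℕ q) k≡1+j (proj₂ k∈)) }
  -- A positive sign orients the arrow from `j + 1` to `j`, so `j + 1` receives none from below.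
  ...   | yes 1+j<q = source n j⁺
      (≡.trans (≡.cong (ℕ._+ n) j⁺≡) (≡.trans (≡.sym (ℕ.+-suc (toℕ j) n)) j+n≡q))
      (≡.subst (toℕ p ℕ.≤_) (≡.sym j⁺≡) (ℕ.m≤n⇒m≤1+n p≤j) , ≡.subst (ℕ._< toℕ q) (≡.sym j⁺≡) 1+j<q)
      λ k _ k<j⁺ → λ
      { (inj₁ (j⁺≡1+k , εk)) → contradiction (≡.trans (≡.sym εj)
          (≡.trans (≡.cong (ε ∘ Fin.suc) (Fin.toℕ-injective (ℕ.suc-injective (≡.trans (≡.sym j⁺≡) j⁺≡1+k)))) εk)) λ ()
      ; (inj₂ (k≡1+j⁺ , _)) → ℕ.<-asym k<j⁺ (ℕ.≤-reflexive (≡.sym k≡1+j⁺)) }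
    where
    1+j<r : ℕ.suc (toℕ j) ℕ.< r
    1+j<r = ℕ.<-≤-trans 1+j<q (Fin.toℕ≤pred[n] q)
    j⁺ = Fin.fromℕ< 1+j<r
    j⁺≡ : toℕ j⁺ ≡ ℕ.suc (toℕ j)
    j⁺≡ = Fin.toℕ-fromℕ< 1+j<r

  -- The walk starts at the lowest vertex of the support of `β p q`, where nothing in the support
  -- lies below to send an arrow.
  root-source : ∀ {p q} → p Fin.< q → ∃[ i ] Between p q i × (∀ k → Between p q k → ¬ Arrow ε k i)
  root-source {p} {q} p<q = source (toℕ q ℕ.∸ toℕ p) j
    (≡.trans (≡.cong (ℕ._+ (toℕ q ℕ.∸ toℕ p)) j≡p) (ℕ.m+[n∸m]≡n (ℕ.<⇒≤ p<q)))
    (ℕ.≤-reflexive (≡.sym j≡p) , ≡.subst (ℕ._< toℕ q) (≡.sym j≡p) p<q)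
    λ k k∈ k<j → contradiction (≡.subst (toℕ k ℕ.<_) j≡p k<j) (ℕ.≤⇒≯ (proj₁ k∈))
    where
    p<r : toℕ p ℕ.< r
    p<r = ℕ.<-≤-trans p<q (Fin.toℕ≤pred[n] q)
    j = Fin.fromℕ< p<r
    j≡p : toℕ j ≡ toℕ p
    j≡p = Fin.toℕ-fromℕ< p<r

  -- At a vertex `j` of the support that receives no arrow from the support, column `j` of the Euler
  -- matrix meets the root only in its diagonal entry.
  positiveRoot-unit : ∀ {w} → PositiveRoot ε w → ∃[ j ] (w ⊡ E) j ≡ 1ℤ
  positiveRoot-unit {w} (p , q , p<q , w≗β) = j , (begin
    (w ⊡ E) j                         ≡⟨ sumℤ-cong (λ k → ≡.cong (ℤ._* E k j) (w≗β k)) ⟩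
    sumℤ (λ k → β p q k ℤ.* E k j)    ≡⟨ sumℤ-single j (λ k k≢j → off-diagonal k≢j (Between? k)) ⟩
    β p q j ℤ.* E j j                 ≡⟨ ≡.cong₂ ℤ._*_ (β-inside {p = p} {q} (proj₁ j∈) (proj₂ j∈)) (euler-diagonal j) ⟩
    1ℤ                                ∎)
    where
    open ≡.≡-Reasoning
    j     = proj₁ (root-source p<q)
    j∈    = proj₁ (proj₂ (root-source p<q))
    isSrc = proj₂ (proj₂ (root-source p<q))
    Between? : ∀ k → Dec (Between p q k)
    Between? k = (toℕ p ℕ.≤? toℕ k) ×-dec (toℕ k ℕ.<? toℕ q)
    off-diagonal : ∀ {k} → k ≢ j → Dec (Between p q k) → β p q k ℤ.* E k j ≡ 0ℤ
    off-diagonal {k} k≢j (yes k∈) = ≡.trans (≡.cong (β p q k ℤ.*_) (euler-off-diagonal k≢j (isSrc k k∈)))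
      (ℤ.*-zeroʳ (β p q k))
    off-diagonal {k} k≢j (no k∉)  = ≡.cong (ℤ._* E k j) (β-outside {p = p} {q} k∉)

  -- Row `i` of the inverse times the Euler matrix is the unit vector at `i`.
  negativeProjectiveRoot-unit : ∀ {w} → NegativeProjectiveRoot ε w → ∃[ j ] (w ⊡ E) j ≡ -1ℤ
  negativeProjectiveRoot-unit {w} (i , π , (E⁻¹ , (_ , E⁻¹E≡δ) , π≗) , w≡-π) = i , (begin
    (w ⊡ E) i                                     ≡⟨ sumℤ-cong (λ k →
      ≡.trans (≡.cong (ℤ._* E k i) (≡.trans (w≡-π k) (≡.cong ℤ.-_ (π≗ k)))) (negate (E⁻¹ i k) (E k i))) ⟩
    sumℤ (λ k → -1ℤ ℤ.* (E⁻¹ i k ℤ.* E k i))      ≡⟨ *-distribˡ-sumℤ -1ℤ (λ k → E⁻¹ i k ℤ.* E k i) ⟨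
    -1ℤ ℤ.* (E⁻¹ ⊗ E) i i                         ≡⟨ ≡.cong (-1ℤ ℤ.*_) (≡.trans (E⁻¹E≡δ i i) (δ-refl i)) ⟩
    -1ℤ                                           ∎)
    where
    open ≡.≡-Reasoning
    negate : ∀ a b → (ℤ.- a) ℤ.* b ≡ -1ℤ ℤ.* (a ℤ.* b)
    negate = solve-∀

  almostPositiveRoot-unit : ∀ {w} → AlmostPositiveRoot ε w → ∃[ j ] ℤ.∣ (w ⊡ E) j ∣ ≡ 1
  almostPositiveRoot-unit (inj₁ w∈) =
    proj₁ (positiveRoot-unit w∈) , ≡.cong ℤ.∣_∣ (proj₂ (positiveRoot-unit w∈))
  almostPositiveRoot-unit (inj₂ w∈) =
    proj₁ (negativeProjectiveRoot-unit w∈) , ≡.cong ℤ.∣_∣ (proj₂ (negativeProjectiveRoot-unit w∈))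

-- Nonnegative matrices, and the tree of internal nodes

module _ {c ℓ₁ ℓ₂} (ℝ : Reals c ℓ₁ ℓ₂) where

  open Reals ℝ
  open RealProperties ℝ
  open Approximation ℝ
  open HCR heytingCommutativeRing using (1#0; #-congʳ)

  -- Nonnegative A and N with A Nᵗ = I: no cancellation can occur, so a nonzero
  -- term of the i-th diagonal entry picks out a column of N supported in row i.
  nonneg-inverse-monomial : ∀ {r} {a : Fin r → Carrier} {N : Fin r → Fin r → ℤ} i →
    (∀ k → 0# ≤ a k) → (∀ l k → 0ℤ ℤ.≤ N l k) →
    (∀ l → sum (λ k → a k * fromℤ (N l k)) ≈ fromℤ (δ i l)) →
    ∃[ k ] N i k ≢ 0ℤ × (∀ l → l ≢ i → N l k ≡ 0ℤ)
  nonneg-inverse-monomial {a = a} {N} i a≥0 N≥0 aN≈δ = k , Nik≢0 , Nlk≡0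
    where
    aN#0 : sum (λ k → a k * fromℤ (N i k)) # 0#
    aN#0 = #-congʳ (sym (trans (aN≈δ i) (trans (reflexive (≡.cong fromℤ (δ-refl i))) fromℤ-1))) 1#0
    k      = proj₁ (sum-# {f = λ k → a k * fromℤ (N i k)} aN#0)
    akNk#0 = proj₂ (sum-# {f = λ k → a k * fromℤ (N i k)} aN#0)
    Nik≢0 : N i k ≢ 0ℤ
    Nik≢0 Nik≡0 = #-irrefl (trans (*-congˡ (reflexive (≡.cong fromℤ Nik≡0))) (zeroʳ (a k))) akNk#0
    Nlk≡0 : ∀ l → l ≢ i → N l k ≡ 0ℤ
    Nlk≡0 l l≢i = ℤ.≤-antisym (ℤ.≮⇒≥ λ 0<Nlk → <-irrefl
      (sym (trans (aN≈δ l) (reflexive (≡.cong fromℤ (δ-≢ (l≢i ∘ ≡.sym))))))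
      (sum-pos (λ j → *-nonneg (a≥0 j) (fromℤ-nonneg (N≥0 l j))) k
        (*-pos (#0∧0≤⇒0< (*-#⇒# akNk#0) (a≥0 k)) (fromℤ-pos 0<Nlk)))) (N≥0 l k)

  module InternalTree {r} (T : MCT ℝ r) where
    open MCT T using (_~_; Internal; t; t-complete; X; X-t)
    module G = MCT T

    t-injective : ∀ {i j} → t i ≡ t j → i ≡ j
    t-injective {i} {j} ti≡tj = Fin.toℕ-injective (ℕ.suc-injective (ℤ.+-injective (fromℤ-injective
      {+ ℕ.suc (toℕ i)} {+ ℕ.suc (toℕ j)}
      (trans (sym (X-t i)) (trans (reflexive (≡.cong X ti≡tj)) (X-t j))))))

    infix 4 _~ᵗ_
    -- Crossing numbers are taken on the internal nodes only, so this induced subgraph must itself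
    -- be a tree: acyclicity is inherited, while connectedness requires removing leaves from walks.
    _~ᵗ_ : Fin (ℕ.suc r) → Fin (ℕ.suc r) → Set
    a ~ᵗ b = t a ~ t b

    ~ᵗ-acyclic : ∀ u v w ws → Unique (u ∷ v ∷ w ∷ ws) → ¬ Linked _~ᵗ_ (u ∷ v ∷ w ∷ ws ++ [ u ])
    ~ᵗ-acyclic u v w ws uniq linked = G.acyclic (t u) (t v) (t w) (List.map t ws)
      (Unique.map⁺ t-injective uniq)
      (≡.subst (Linked _~_) (map-++ t (u ∷ v ∷ w ∷ ws) [ u ]) (Linked.map⁺ linked))

    -- A walk that enters a leaf has to return to the node it came from.
    internalWalk : ∀ {u b} a → u ≡ t a → Star _~_ u (t b) → Star _~ᵗ_ a b
    internalWalk {b = b} a tb≡ta nil = ≡.subst (λ x → Star _~ᵗ_ x b) (t-injective tb≡ta) nil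
    internalWalk a ≡.refl (_◅_ {j = x} e w) with Fin.any? (λ i → x Fin.≟ t i)
    ... | yes (i , ≡.refl) = e ◅ internalWalk i ≡.refl w
    internalWalk {b = b} a ≡.refl (e ◅ nil) | no x≢t = contradiction (b , ≡.refl) x≢t
    internalWalk a ≡.refl (_◅_ {j = x} e (_◅_ {j = y} e′ w)) | no x≢t with y Fin.≟ t a
    ... | yes y≡ta = internalWalk a y≡ta w
    ... | no  y≢ta = contradiction (t-complete x x-internal) x≢t
      where
      x-internal : Internal x
      x-internal (z , _ , unique) = y≢ta (≡.trans (≡.sym (unique e′)) (unique (G.sym e)))

    ~ᵗ-connected : ∀ a b → Star _~ᵗ_ a b
    ~ᵗ-connected a b = internalWalk a ≡.refl (G.connected (t a) (t b))

-- The matrix `N` and the matching of c-vectors with roots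

module _ {c ℓ₁ ℓ₂} (ℝ : Reals c ℓ₁ ℓ₂) {r} (ε : Vector Sign (ℕ.suc r))
  (v : Vector (Vector ℤ r) r) (roots : ∀ k → AlmostPositiveRoot ε (v k))
  (T : MCT ℝ r) (ℓ : MCT.EdgeNumbering T)
  (R≐ : closure ℝ (MCT.EdgeNumbering.region ℓ) ≐ clusterRegion ℝ ε v)
  where

  open Reals ℝ hiding (complete)
  open RealProperties ℝ
  open Approximation ℝ
  open SemiringSum semiring using (sum-cong-≋; *-distribˡ-sum)
  open InternalTree ℝ T
  open MCT.EdgeNumbering ℓ using (p; q; p<q; adjacent; injective; complete; cVector; sgn)
  open TreePotentials {_~_ = _~ᵗ_} G.sym (G.irrefl ≡.refl) ~ᵗ-acyclic ~ᵗ-connected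
    p<q adjacent injective complete
  open Region p q (λ i → MCT.slopeSign T (adjacent i))
  open Cone ε v

  sgn² : ∀ l → sgn l ℤ.* sgn l ≡ 1ℤ
  sgn² l = ◃-square (MCT.slopeSign T (adjacent l))

  slope : Vector ℤ (ℕ.suc r) → Vector ℤ r
  slope x l = sgn l ℤ.* (x (q l) ℤ.- x (p l))

  rise : ∀ x l → x (q l) ℤ.- x (p l) ≡ sgn l ℤ.* slope x l
  rise x l = ≡.sym (≡.trans (≡.sym (ℤ.*-assoc (sgn l) (sgn l) _))
    (≡.trans (≡.cong (ℤ._* (x (q l) ℤ.- x (p l))) (sgn² l)) (ℤ.*-identityˡ _)))

  N : Fin r → Fin r → ℤ
  N l k = slope (Y k) l

  form-cVector : ∀ k l → form (v k) E (cVector l) ≡ N l k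
  form-cVector k l = form-β (v k) E (sgn l) (ℕ.<⇒≤ (p<q l))

  N-nonneg : ∀ l k → 0ℤ ℤ.≤ N l k
  N-nonneg l k = closure⇒nonneg (Y k) (proj₂ R≐ (generator∈ k)) l

  dual : Fin r → Vector ℤ (ℕ.suc r)
  dual i m = sgn i ℤ.* h i m

  slope-dual : ∀ i l → slope (dual i) l ≡ δ i l
  slope-dual i l = ≡.trans (factor (sgn l) (sgn i) (h i (q l)) (h i (p l)))
    (≡.trans (≡.cong (sgn l ℤ.* sgn i ℤ.*_) (h-edge i l)) (diagonal (i Fin.≟ l)))
    where
    factor : ∀ a b x y → a ℤ.* (b ℤ.* x ℤ.- b ℤ.* y) ≡ a ℤ.* b ℤ.* (x ℤ.- y)
    factor = solve-∀
    diagonal : Dec (i ≡ l) → sgn l ℤ.* sgn i ℤ.* δ i l ≡ δ i l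
    diagonal (yes ≡.refl) = ≡.trans (≡.cong (ℤ._* δ i i) (sgn² i)) (ℤ.*-identityˡ _)
    diagonal (no i≢l)     = ≡.trans (≡.cong (sgn l ℤ.* sgn i ℤ.*_) (δ-≢ i≢l))
      (≡.trans (ℤ.*-zeroʳ (sgn l ℤ.* sgn i)) (≡.sym (δ-≢ i≢l)))

  -- A point with all slopes 1: the direction in which `nonneg⇒closure` pushes points of the closed
  -- region into the open one.
  interior : Vector ℤ (ℕ.suc r)
  interior m = sumℤ (λ j → dual j m)

  slope-interior : ∀ l → slope interior l ≡ 1ℤ
  slope-interior l = begin
    sgn l ℤ.* (interior (q l) ℤ.- interior (p l)) ≡⟨ ≡.cong (sgn l ℤ.*_) (≡.cong (λ d → interior (q l) ℤ.+ d)
      (≡.trans (≡.sym (ℤ.-1*i≡-i _)) (*-distribˡ-sumℤ -1ℤ (λ j → dual j (p l))))) ⟩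
    sgn l ℤ.* (interior (q l) ℤ.+ sumℤ (λ j → -1ℤ ℤ.* dual j (p l)))
      ≡⟨ ≡.cong (sgn l ℤ.*_) (sumℤ-+ (λ j → dual j (q l)) (λ j → -1ℤ ℤ.* dual j (p l))) ⟨
    sgn l ℤ.* sumℤ (λ j → dual j (q l) ℤ.+ -1ℤ ℤ.* dual j (p l))
      ≡⟨ *-distribˡ-sumℤ (sgn l) (λ j → dual j (q l) ℤ.+ -1ℤ ℤ.* dual j (p l)) ⟩
    sumℤ (λ j → sgn l ℤ.* (dual j (q l) ℤ.+ -1ℤ ℤ.* dual j (p l)))
      ≡⟨ sumℤ-cong (λ j → ≡.trans (≡.cong (λ d → sgn l ℤ.* (dual j (q l) ℤ.+ d)) (ℤ.-1*i≡-i (dual j (p l))))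
        (slope-dual j l)) ⟩
    sumℤ (λ j → δ j l)                            ≡⟨ sumℤ-single l (λ j → δ-≢) ⟩
    δ l l                                         ≡⟨ δ-refl l ⟩
    1ℤ                                            ∎
    where open ≡.≡-Reasoning

  -- The slopes are `δ i l`, hence nonnegative. The cone coefficients obtained in this way form row
  -- `i` of the matrix `A`.
  dual∈ : ∀ i → clusterRegion ℝ ε v (fromℤ ∘ dual i)
  dual∈ i = proj₁ R≐ (nonneg⇒closure interior (dual i) slope-interior
    λ l → ≡.subst (0ℤ ℤ.≤_) (≡.sym (slope-dual i l)) (δ-nonneg i l))

  MonomialColumn : Fin r → Fin r → Set
  MonomialColumn i k = N i k ≢ 0ℤ × (∀ l → l ≢ i → N l k ≡ 0ℤ)

  -- Taking the slope along `ℓ_l` of the cone expansion of `dual i` gives `Σ_k a_k N_lk = δ_il`, one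
  -- row of `A Nᵗ = I`.
  coordinates⇒column : ∀ i → Σ[ a ∈ Vector Carrier r ] (∀ k → 0# ≤ a k) × (∀ p q →
    fromℤ (dual i q) - fromℤ (dual i p) ≈ sum (λ k → a k * fromℤ (Y k q ℤ.- Y k p))) →
    ∃[ k ] MonomialColumn i k
  coordinates⇒column i (a , a≥0 , x≈) = nonneg-inverse-monomial ℝ {a = a} {N} i a≥0 N-nonneg λ l → begin
    sum (λ k → a k * fromℤ (N l k))
      ≈⟨ sum-cong-≋ (λ k → pull (a k) (sgn l) (Y k (q l) ℤ.- Y k (p l))) ⟩
    sum (λ k → fromℤ (sgn l) * (a k * fromℤ (Y k (q l) ℤ.- Y k (p l))))
      ≈⟨ *-distribˡ-sum (fromℤ (sgn l)) (λ k → a k * fromℤ (Y k (q l) ℤ.- Y k (p l))) ⟨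
    fromℤ (sgn l) * sum (λ k → a k * fromℤ (Y k (q l) ℤ.- Y k (p l)))
      ≈⟨ *-congˡ (x≈ (p l) (q l)) ⟨
    fromℤ (sgn l) * (fromℤ (dual i (q l)) - fromℤ (dual i (p l)))
      ≈⟨ *-congˡ (fromℤ-sub (dual i (q l)) (dual i (p l))) ⟨
    fromℤ (sgn l) * fromℤ (dual i (q l) ℤ.- dual i (p l))
      ≈⟨ fromℤ-* (sgn l) (dual i (q l) ℤ.- dual i (p l)) ⟨
    fromℤ (slope (dual i) l)
      ≡⟨ ≡.cong fromℤ (slope-dual i l) ⟩
    fromℤ (δ i l)
      ∎
    where
    open ≈-Reasoning
    pull : ∀ x s z → x * fromℤ (s ℤ.* z) ≈ fromℤ s * (x * fromℤ z)
    pull x s z = trans (*-congˡ (fromℤ-* s z))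
      (solve 3 (λ x s z → x :* (s :* z) := s :* (x :* z)) refl x (fromℤ s) (fromℤ z))
      where open Solver

  -- From here on only the column matters, not the real coefficients that located it.
  abstract
    column : ∀ i → ∃[ k ] MonomialColumn i k
    column i = coordinates⇒column i (coordinates (dual∈ i))

  -- For `i ≢ j` the column of `i` vanishes in row `j`, whereas the column of `j` does not.
  column-injective : ∀ {i j} → proj₁ (column i) ≡ proj₁ (column j) → i ≡ j
  column-injective {i} {j} eq = decidable-stable (i Fin.≟ j) λ i≢j → proj₁ (proj₂ (column j))
    (≡.subst (λ k → N j k ≡ 0ℤ) eq (proj₂ (proj₂ (column i)) j (i≢j ∘ ≡.sym)))

  -- Sends `k` to the row of the only nonzero entry in column `k` of `N`, that is, to the edge
  -- matched with `v k`.
  σ : Permutation′ r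
  σ = proj₁ (injective⇒permutation (proj₁ ∘ column) column-injective)

  column-σ : ∀ k → proj₁ (column (σ ⟨$⟩ʳ k)) ≡ k
  column-σ = proj₂ (injective⇒permutation (proj₁ ∘ column) column-injective)

  N-off : ∀ {l k} → l ≢ σ ⟨$⟩ʳ k → N l k ≡ 0ℤ
  N-off {l} {k} l≢σk = ≡.subst (λ k′ → N l k′ ≡ 0ℤ) (column-σ k)
    (proj₂ (proj₂ (column (σ ⟨$⟩ʳ k))) l l≢σk)

  -- Only the edge `σ k` survives in the expansion of `Y k`. The second factor is an integer, so
  -- `N (σ k) k` divides every entry of `v k ⊡ E`.
  ⊡-dual : ∀ k m → (v k ⊡ E) m ≡ N (σ ⟨$⟩ʳ k) k ℤ.* (sgn (σ ⟨$⟩ʳ k) ℤ.* Δ (h (σ ⟨$⟩ʳ k)) m)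
  ⊡-dual k m = begin
    (v k ⊡ E) m                                             ≡⟨ Δ-potential (v k ⊡ E) m ⟨
    Δ (Y k) m                                               ≡⟨ Δ-expansion (Y k) m ⟨
    sumℤ (λ l → (Y k (q l) ℤ.- Y k (p l)) ℤ.* Δ (h l) m)    ≡⟨ sumℤ-single (σ ⟨$⟩ʳ k) (λ l l≢σk →
      ≡.cong (ℤ._* Δ (h l) m) (≡.trans (rise (Y k) l)
        (≡.trans (≡.cong (sgn l ℤ.*_) (N-off l≢σk)) (ℤ.*-zeroʳ (sgn l))))) ⟩
    (Y k (q i) ℤ.- Y k (p i)) ℤ.* Δ (h i) m                 ≡⟨ ≡.cong (ℤ._* Δ (h i) m) (rise (Y k) i) ⟩
    sgn i ℤ.* N i k ℤ.* Δ (h i) m                           ≡⟨ rearrange (sgn i) (N i k) (Δ (h i) m) ⟩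
    N i k ℤ.* (sgn i ℤ.* Δ (h i) m)                         ∎
    where
    open ≡.≡-Reasoning
    i = σ ⟨$⟩ʳ k
    rearrange : ∀ a b c → a ℤ.* b ℤ.* c ≡ b ℤ.* (a ℤ.* c)
    rearrange = solve-∀

  -- A nonnegative integer that divides an entry of absolute value 1.
  N-diagonal : ∀ k → N (σ ⟨$⟩ʳ k) k ≡ 1ℤ
  N-diagonal k = ≡.trans (≡.sym (ℤ.0≤i⇒+∣i∣≡i (N-nonneg (σ ⟨$⟩ʳ k) k)))
    (≡.cong +_ (ℕ.m*n≡1⇒m≡1 _ _ (≡.trans (≡.sym (ℤ.abs-* (N (σ ⟨$⟩ʳ k) k) _))
      (≡.trans (≡.cong ℤ.∣_∣ (≡.sym (⊡-dual k m))) unit))))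
    where
    m    = proj₁ (almostPositiveRoot-unit ε (roots k))
    unit = proj₂ (almostPositiveRoot-unit ε (roots k))

  N-σ : ∀ i j → N (σ ⟨$⟩ʳ j) i ≡ δ i j
  N-σ i j = helper (i Fin.≟ j)
    where
    helper : Dec (i ≡ j) → N (σ ⟨$⟩ʳ j) i ≡ δ i j
    helper (yes ≡.refl) = ≡.trans (N-diagonal i) (≡.sym (δ-refl i))
    helper (no i≢j)     = ≡.trans (N-off λ σj≡σi → i≢j (≡.trans (≡.sym (column-σ i))
      (≡.trans (≡.cong (proj₁ ∘ column) (≡.sym σj≡σi)) (column-σ j)))) (≡.sym (δ-≢ i≢j))

  form-δ : ∀ i j → form (v i) E (cVector (σ ⟨$⟩ʳ j)) ≡ δ i j
  form-δ i j = ≡.trans (form-cVector i (σ ⟨$⟩ʳ j)) (N-σ i j)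

  -- One product is `form-δ`. The other, up to the order of its summands, is the expansion of
  -- `potential (δ i)` along the tree edges, where the two signs contributed by each edge cancel.
  classical : AreClassicalCVectors ε v (cVector ∘ (σ ⟨$⟩ʳ_))
  classical = (λ i j → ≡.trans (≡.sym (form-⊡ (v i) E (cVector (σ ⟨$⟩ʳ j)))) (form-δ i j)) , right
    where
    open ≡.≡-Reasoning
    right : ∀ i j → sumℤ (λ k → cVector (σ ⟨$⟩ʳ k) i ℤ.* (v k ⊡ E) j) ≡ δ i j
    right i j = begin
      sumℤ (λ k → cVector (σ ⟨$⟩ʳ k) i ℤ.* (v k ⊡ E) j)               ≡⟨ sumℤ-cong term ⟩
      sumℤ (λ k → summand (σ ⟨$⟩ʳ k))                                 ≡⟨ sumℤ-permute summand σ ⟨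
      sumℤ summand                                                    ≡⟨ Δ-expansion (potential (δ i)) j ⟩
      Δ (potential (δ i)) j                                           ≡⟨ Δ-potential (δ i) j ⟩
      δ i j                                                           ∎
      where
      x : Vector ℤ (ℕ.suc r)
      x = potential (δ i)
      summand : Fin r → ℤ
      summand l = (x (q l) ℤ.- x (p l)) ℤ.* Δ (h l) j
      square : ∀ s b d → s ℤ.* b ℤ.* (1ℤ ℤ.* (s ℤ.* d)) ≡ s ℤ.* s ℤ.* (b ℤ.* d)
      square = solve-∀
      term : ∀ k → cVector (σ ⟨$⟩ʳ k) i ℤ.* (v k ⊡ E) j ≡ summand (σ ⟨$⟩ʳ k)
      term k = begin
        sgn l ℤ.* β (p l) (q l) i ℤ.* (v k ⊡ E) j
          ≡⟨ ≡.cong (sgn l ℤ.* β (p l) (q l) i ℤ.*_) (≡.trans (⊡-dual k j)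
            (≡.cong (ℤ._* (sgn l ℤ.* Δ (h l) j)) (N-diagonal k))) ⟩
        sgn l ℤ.* β (p l) (q l) i ℤ.* (1ℤ ℤ.* (sgn l ℤ.* Δ (h l) j))
          ≡⟨ square (sgn l) (β (p l) (q l) i) (Δ (h l) j) ⟩
        sgn l ℤ.* sgn l ℤ.* (β (p l) (q l) i ℤ.* Δ (h l) j)
          ≡⟨ ≡.trans (≡.cong (ℤ._* (β (p l) (q l) i ℤ.* Δ (h l) j)) (sgn² l)) (ℤ.*-identityˡ _) ⟩
        β (p l) (q l) i ℤ.* Δ (h l) j
          ≡⟨ ≡.cong (ℤ._* Δ (h l) j) (β-potential i (ℕ.<⇒≤ (p<q l))) ⟨
        summand l ∎
        where l = σ ⟨$⟩ʳ k

corollary2 :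
    ∀ {c ℓ₁ ℓ₂} (ℝ : Reals c ℓ₁ ℓ₂) →
    ∀ (r : ℕ) → 2 ℕ.≤ ℕ.suc r →
    ∀ (ε : Vector Sign (ℕ.suc r)) →
    ∀ (v : Vector (Vector ℤ r) r) → IsCluster ε v →
    ∀ (T : MCT ℝ r) (ℓ : MCT.EdgeNumbering T) →
    let cT = MCT.EdgeNumbering.cVector ℓ in
    MCT.signVector T ≗ ε →
    closure ℝ (MCT.EdgeNumbering.region ℓ) ≐ clusterRegion ℝ ε v →
    Σ[ σ ∈ Permutation′ r ]
      (∃[ c′ ] AreClassicalCVectors ε v c′ × (∀ j → cT (σ ⟨$⟩ʳ j) ≗ c′ j)) ×
      (∀ i j → form (v i) (eulerMatrix ε) (cT (σ ⟨$⟩ʳ j)) ≡ δ i j)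
corollary2 ℝ r _ ε v isCluster T ℓ _ R≐ =
  -- The permuted c-vectors themselves serve as `c′`: a two-sided inverse is unique, so they are the
  -- classical ones.
  σ′ , (_ , classical ℝ ε v roots T ℓ R≐ , λ j k → ≡.refl) , form-δ ℝ ε v roots T ℓ R≐
  where
  roots = IsCluster.almostPositive isCluster
  σ′ = σ ℝ ε v roots T ℓ R≐
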